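{- Let $G$ be a planar graph with $n\ge 36$ vertices. Then $G$ has a $(2,n)$-differential coloring if and only if $G$ contains none of the graphs $K_{1,1,n-3}$, $K_{1,n-1}$ and $K_{2,n-2}$ as a subgraph.
   Context: Graphs are finite, simple and undirected. A $(2,n)$-differential coloring of an $n$-vertex graph $G=(V,E)$ is an assignment of pairwise distinct colors from $\{1,\dots,n\}$ to the vertices, i.e. a bijection $c:V\to\{1,\dots,n\}$, such that $|c(u)-c(v)|\ge 2$ for every edge $(u,v)\in E$. Subgraphs are not required to be induced. $K_{a,b}$ denotes the complete bipartite graph with parts of sizes $a,b$, and $K_{1,1,n-3}$ the complete tripartite graph with parts of sizes $1,1,n-3$ (so it has $n-1$ vertices). -}

module Defs where

open import Data.Bool.Base using (Bool; not; T)
open import Data.Fin.Base using (Fin; zero; suc; toℕ; splitAt)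
open import Data.Fin.Properties using (_≟_)
open import Data.List.Base using (List; []; _∷_; length)
open import Data.Nat.ListAction using (sum)
open import Data.Nat.Base using (ℕ; suc; _+_; _*_; _≤_; ∣_-_∣)
open import Data.Product.Base using (Σ; ∃; ∃-syntax; _×_; _,_)
open import Data.Sum.Base using ([_,_]′)
open import Function.Base using (const; _∘_)
open import Function.Bundles using (Bijection; Injection; Inverse; _⤖_; _↔_; _↣_)
open import Level using (0ℓ)
open import Relation.Binary.Construct.Closure.Equivalence using (EqClosure) renaming (setoid to closureSetoid)
open import Relation.Binary.Construct.Union using (_∪_)
open import Relation.Binary.Core using (Rel)
open import Relation.Binary.Definitions using (Symmetric; Irreflexive)
open import Relation.Binary.PropositionalEquality using (_≡_; refl; sym; setoid)
open import Relation.Nullary.Decidable using (⌊_⌋; toWitnessFalse; fromWitnessFalse)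

record Graph (n : ℕ) : Set where
  field
    adj : Fin n → Fin n → Bool

  Adj : Rel (Fin n) 0ℓ
  Adj u v = T (adj u v)

  field
    adj-sym    : Symmetric Adj
    adj-irrefl : Irreflexive _≡_ Adj

open Graph public using (Adj)

-- H is isomorphic to a (not necessarily induced) subgraph of G.
_⊑_ : ∀ {m n} → Graph m → Graph n → Set
_⊑_ {m} {n} H G =
  Σ (Fin m ↣ Fin n) λ f → ∀ u v → Adj H u v → Adj G (Injection.to f u) (Injection.to f v)

part : (as : List ℕ) → Fin (sum as) → Fin (length as)
part (a ∷ as) v = [ const zero , suc ∘ part as ]′ (splitAt a v)

-- The complete multipartite graph with parts of the given sizes.
K : (as : List ℕ) → Graph (sum as)
K as = record
  { adj        = λ u v → not ⌊ part as u ≟ part as v ⌋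
  ; adj-sym    = λ p → fromWitnessFalse (toWitnessFalse p ∘ sym)
  ; adj-irrefl = λ { refl p → toWitnessFalse p refl }
  }

-- The colour set {1,…,n} is the image of Fin n under suc ∘ toℕ.
DifferentialColoring : ∀ {n} → ℕ → Graph n → Set
DifferentialColoring {n} k G =
  Σ (Fin n ⤖ Fin n) λ c →
    let colour = λ v → suc (toℕ (Bijection.to c v)) in
    ∀ u v → Adj G u v → k ≤ ∣ colour u - colour v ∣

-- Planarity is expressed by combinatorial embeddings (rotation systems):
-- a cyclic order of the outgoing darts around every vertex, such that the
-- induced cellular embedding of every component lies in the sphere.

record Dart {n} (G : Graph n) : Set where
  constructor dart
  field
    tail head : Fin n
    edge      : Adj G tail head

open Dart public using (tail; head)

rev : ∀ {n} {G : Graph n} → Dart G → Dart G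
rev {G = G} (dart u v e) = dart v u (Graph.adj-sym G e)

Step : ∀ {A : Set} → (A → A) → Rel A 0ℓ
Step f x y = f x ≡ y

-- The equivalence relation generated by R has exactly k classes.
HasClasses : ∀ {A : Set} → Rel A 0ℓ → ℕ → Set
HasClasses R k = Bijection (closureSetoid R) (setoid (Fin k))

record Rotation {n} (G : Graph n) : Set where
  field
    perm   : Dart G ↔ Dart G

  next : Dart G → Dart G
  next = Inverse.to perm

  field
    tail-next : ∀ d → tail (next d) ≡ tail d
    cyclic    : ∀ d e → tail d ≡ tail e → EqClosure (Step next) d e

  -- Traverse an edge, then turn to the next dart around the vertex reached.
  faceStep : Dart G → Dart G
  faceStep = next ∘ rev

-- Euler's formula summed over components.  All four numbers count classes of
-- darts, so an isolated vertex, whose component has V = F = 1, E = 0 and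
-- thus satisfies V + F = E + 2, is left out of both sides.
GenusZero : ∀ {n} {G : Graph n} → Rotation G → Set
GenusZero {G = G} ρ =
  ∃[ V ] ∃[ E ] ∃[ F ] ∃[ C ]
    HasClasses (Step next) V ×
    HasClasses (Step (rev {G = G})) E ×
    HasClasses (Step faceStep) F ×
    HasClasses (Step next ∪ Step rev) C ×
    V + F ≡ E + 2 * C
  where open Rotation ρ

Planar : ∀ {n} → Graph n → Set
Planar G = ∃ λ (ρ : Rotation G) → GenusZero ρ

{-# OPTIONS --safe #-}
module Submission where

-- A colouring is a Hamiltonian path of the complement of G, and the Bondy–Chvátal closure reduces
-- its existence to a subgraph H of G in which adjacent vertices have degree sum at least n.  The
-- only consequence of planarity needed is that a cut of G has at most 2n edges; it follows from
-- Euler's formula for G itself, because a triangular face has a side inside one of the two classes.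
-- With k vertices of degree at least n/2 on one side of the cut, it shows that H has at most five
-- such "heavy" vertices.  Every edge of H has a heavy end, so a light vertex has degree at most five,
-- a heavy one has a light neighbour and therefore degree at least n - 5, and the same cut bound now
-- leaves at most two heavy vertices a and b, of degree n - 2 at least.  All other vertices are
-- pairwise non-adjacent, so the path a, a', …, b', b exists in the complement of H unless one of the
-- three forbidden graphs occurs.

open import Defs
open import Data.Bool.Base using (Bool; true; false; T; not; _∧_; _∨_; _xor_)
open import Data.Bool.Properties using (T?; T-irrelevant; T-∧; T-∨)
open import Data.Fin.Base using (Fin; zero; suc; cast; toℕ; fromℕ<)
import Data.Fin.Properties as Fin
open import Data.List.Base
  using (List; []; _∷_; _++_; _ʳ++_; length; map; filter; cartesianProduct; allFin; concatMap; lookup)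
open import Data.List.Properties
  using (length-++; length-map; length-tabulate; length-take; map-++; map-∘; ++-assoc; ++-identityʳ)
open import Data.List.Membership.Propositional using (_∈_)
open import Data.List.Membership.Propositional.Properties
import Data.List.Membership.DecPropositional as DecMembership
open import Data.List.Relation.Binary.Disjoint.Propositional using (Disjoint)
open import Data.List.Relation.Binary.Permutation.Propositional
  using (_↭_; ↭-refl; ↭-sym; ↭-trans; ↭-reflexive; ↭⇒↭ₛ; prep; swap)
open import Data.List.Relation.Binary.Permutation.Propositional.Properties
  using (∈-resp-↭; shift; shifts; ++-comm; ↭-length; map⁺)
open import Data.List.Relation.Binary.Permutation.Setoid.Properties using (Unique-resp-↭)
open import Data.List.Relation.Binary.Subset.Propositional using (_⊆_)
import Data.List.Relation.Unary.All as All
open import Data.List.Relation.Unary.All using (All; []; _∷_)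
import Data.List.Relation.Unary.All.Properties as All
open import Data.List.Relation.Unary.AllPairs using ([]; _∷_)
import Data.List.Relation.Unary.AllPairs as AllPairs
import Data.List.Relation.Unary.AllPairs.Properties as AllPairs
import Data.List.Relation.Unary.Any as Any
open import Data.List.Relation.Unary.Any using (here; there)
open import Data.List.Relation.Unary.Any.Properties using (lookup-index)
open import Data.List.Relation.Unary.Linked using (Linked; []; [-]; _∷_)
open import Data.List.Relation.Unary.Unique.Propositional using (Unique)
import Data.List.Relation.Unary.Unique.Propositional.Properties as Unique
open import Data.Nat.Base
open import Data.Nat.Induction using (Acc; acc; <-wellFounded)
open import Data.Nat.ListAction using (sum)
open import Data.Nat.ListAction.Properties using (sum-++; sum-↭)
open import Data.Nat.Properties
open import Data.Nat.Tactic.RingSolver using (solve-∀)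
open import Data.Product.Base using (∃; ∃₂; _×_; _,_; proj₁; proj₂)
open import Data.Product.Properties using (≡-dec)
open import Data.Sum.Base using (_⊎_; inj₁; inj₂)
open import Data.Sum.Properties using (inj₁-injective; inj₂-injective)
open import Function.Base using (_∘_; const; id)
open import Function.Bundles
  using (Bijection; Equivalence; Injection; Surjection; _↣_; _⇔_; mk↣; mk⇔; mk⤖)
open import Function.Properties.Inverse using (Inverse⇒Injection)
open import Level using (0ℓ)
open import Relation.Binary.Construct.Closure.Equivalence using (EqClosure)
open import Relation.Binary.Construct.Closure.ReflexiveTransitive using (ε; _◅_)
open import Relation.Binary.Construct.Closure.Symmetric using (fwd; bwd)
open import Relation.Binary.Core using (Rel)
open import Relation.Binary.PropositionalEquality
open import Relation.Nullary using (¬_; Dec; contradiction; yes; no; does; ¬?)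
open import Relation.Nullary.Decidable
  using (⌊_⌋; map′; _×-dec_; _⊎-dec_; dec-true; decidable-stable; fromWitness; fromWitnessFalse; toWitnessFalse)

private variable
  A B : Set

-- Sums and lists

∑ : List A → (A → ℕ) → ℕ
∑ xs f = sum (map f xs)

⟦_⟧ : Bool → ℕ
⟦ true ⟧  = 1
⟦ false ⟧ = 0

∑-mono : ∀ {f g : A → ℕ} → (∀ x → f x ≤ g x) → ∀ xs → ∑ xs f ≤ ∑ xs g
∑-mono f≤g []       = z≤n
∑-mono f≤g (x ∷ xs) = +-mono-≤ (f≤g x) (∑-mono f≤g xs)

∑-mono-< : ∀ {f g : A → ℕ} → (∀ x → f x ≤ g x) → ∀ {x xs} → x ∈ xs → f x < g x → ∑ xs f < ∑ xs g
∑-mono-< f≤g {xs = x ∷ xs} (here refl) fx<gx = +-mono-<-≤ fx<gx (∑-mono f≤g xs)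
∑-mono-< f≤g {xs = y ∷ xs} (there x∈)  fx<gx = +-mono-≤-< (f≤g y) (∑-mono-< f≤g x∈ fx<gx)

∑-cong : ∀ {f g : A → ℕ} → (∀ x → f x ≡ g x) → ∀ xs → ∑ xs f ≡ ∑ xs g
∑-cong f≡g []       = refl
∑-cong f≡g (x ∷ xs) = cong₂ _+_ (f≡g x) (∑-cong f≡g xs)

∑-+ : ∀ (f g : A → ℕ) xs → ∑ xs (λ x → f x + g x) ≡ ∑ xs f + ∑ xs g
∑-+ f g []       = refl
∑-+ f g (x ∷ xs) = begin
  (f x + g x) + ∑ xs (λ x → f x + g x)  ≡⟨ cong (f x + g x +_) (∑-+ f g xs) ⟩
  (f x + g x) + (∑ xs f + ∑ xs g)       ≡⟨ interchange (f x) (g x) _ _ ⟩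
  (f x + ∑ xs f) + (g x + ∑ xs g)       ∎
  where
  open ≡-Reasoning
  interchange : ∀ a b c d → (a + b) + (c + d) ≡ (a + c) + (b + d)
  interchange = solve-∀

∑-* : ∀ c (f : A → ℕ) xs → ∑ xs (λ x → c * f x) ≡ c * ∑ xs f
∑-* c f []       = sym (*-zeroʳ c)
∑-* c f (x ∷ xs) = trans (cong (c * f x +_) (∑-* c f xs)) (sym (*-distribˡ-+ c (f x) _))

∑-const : ∀ c (xs : List A) → ∑ xs (const c) ≡ length xs * c
∑-const c []       = refl
∑-const c (x ∷ xs) = cong (c +_) (∑-const c xs)

∑-comm : ∀ (f : A → B → ℕ) xs ys → ∑ xs (λ x → ∑ ys (f x)) ≡ ∑ ys (λ y → ∑ xs (λ x → f x y))
∑-comm f []       ys = sym (trans (∑-const 0 ys) (*-zeroʳ (length ys)))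
∑-comm f (x ∷ xs) ys = begin
  ∑ ys (f x) + ∑ xs (λ x → ∑ ys (f x))            ≡⟨ cong (∑ ys (f x) +_) (∑-comm f xs ys) ⟩
  ∑ ys (f x) + ∑ ys (λ y → ∑ xs (λ x → f x y))    ≡⟨ ∑-+ (f x) _ ys ⟨
  ∑ ys (λ y → f x y + ∑ xs (λ x → f x y))         ∎
  where open ≡-Reasoning

∑-++ : ∀ (f : A → ℕ) xs ys → ∑ (xs ++ ys) f ≡ ∑ xs f + ∑ ys f
∑-++ f xs ys = trans (cong sum (map-++ f xs ys)) (sum-++ (map f xs) (map f ys))

∑-↭ : ∀ (f : A → ℕ) {xs ys} → xs ↭ ys → ∑ xs f ≡ ∑ ys f
∑-↭ f p = sum-↭ (map⁺ f p)

∑-cartesianProduct : ∀ (f : A × B → ℕ) xs ys →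
  ∑ (cartesianProduct xs ys) f ≡ ∑ xs (λ x → ∑ ys (λ y → f (x , y)))
∑-cartesianProduct f []       ys = refl
∑-cartesianProduct f (x ∷ xs) ys = begin
  ∑ (map (x ,_) ys ++ cartesianProduct xs ys) f                 ≡⟨ ∑-++ f (map (x ,_) ys) _ ⟩
  ∑ (map (x ,_) ys) f + ∑ (cartesianProduct xs ys) f
    ≡⟨ cong₂ _+_ (cong sum (sym (map-∘ ys))) (∑-cartesianProduct f xs ys) ⟩
  ∑ ys (λ y → f (x , y)) + ∑ xs (λ x → ∑ ys (λ y → f (x , y)))  ∎
  where open ≡-Reasoning

length-filter-∑ : ∀ {P : A → Set} (P? : ∀ x → Dec (P x)) xs → length (filter P? xs) ≡ ∑ xs (λ x → ⟦ does (P? x) ⟧)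
length-filter-∑ P? []       = refl
length-filter-∑ P? (x ∷ xs) with does (P? x)
... | true  = cong suc (length-filter-∑ P? xs)
... | false = length-filter-∑ P? xs

Unique⊆⇒↭++ : ∀ {xs ys : List A} → Unique xs → xs ⊆ ys → ∃ λ zs → ys ↭ xs ++ zs
Unique⊆⇒↭++ {xs = []}     {ys} []           _   = ys , ↭-refl
Unique⊆⇒↭++ {xs = x ∷ xs} {ys} (x∉xs ∷ xs!) x∷xs⊆ys with ∈-∃++ (x∷xs⊆ys (here refl))
... | as , bs , refl with Unique⊆⇒↭++ xs! xs⊆as++bs
  where
  xs⊆as++bs : xs ⊆ as ++ bs
  xs⊆as++bs {y} y∈xs with ∈-++⁻ as (x∷xs⊆ys (there y∈xs))
  ... | inj₁ y∈as          = ∈-++⁺ˡ y∈as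
  ... | inj₂ (here y≡x)    = contradiction (sym y≡x) (All.lookup x∉xs y∈xs)
  ... | inj₂ (there y∈bs)  = ∈-++⁺ʳ as y∈bs
... | zs , as++bs↭xs++zs = zs , ↭-trans (shift x as bs) (prep x as++bs↭xs++zs)

Unique⊆⇒length≤ : ∀ {xs ys : List A} → Unique xs → xs ⊆ ys → length xs ≤ length ys
Unique⊆⇒length≤ {xs = xs} {ys} xs! xs⊆ys with Unique⊆⇒↭++ xs! xs⊆ys
... | zs , p = begin
  length xs               ≤⟨ m≤m+n _ _ ⟩
  length xs + length zs   ≡⟨ length-++ xs ⟨
  length (xs ++ zs)       ≡⟨ ↭-length p ⟨
  length ys               ∎
  where open ≤-Reasoning

Unique-↭ : ∀ {xs ys : List A} → xs ↭ ys → Unique xs → Unique ys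
Unique-↭ p = Unique-resp-↭ (setoid _) (↭⇒↭ₛ p)

-- Euler's formula and cuts

length-concatMap : ∀ {c} {f : A → List B} → (∀ x → length (f x) ≡ c) → ∀ xs →
  length (concatMap f xs) ≡ length xs * c
length-concatMap         eq []       = refl
length-concatMap {f = f} eq (x ∷ xs) =
  trans (length-++ (f x)) (cong₂ _+_ (eq x) (length-concatMap eq xs))

length-⊎ : ∀ (xs : List A) (ys : List B) → length (map inj₁ xs ++ map inj₂ ys) ≡ length xs + length ys
length-⊎ xs ys = trans (length-++ (map inj₁ xs)) (cong₂ _+_ (length-map inj₁ xs) (length-map inj₂ ys))

length-allFin : ∀ n → length (allFin n) ≡ n
length-allFin n = length-tabulate (λ i → i)

∈-pair : ∀ {n} (p : Fin n × Fin n) → p ∈ cartesianProduct (allFin n) (allFin n)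
∈-pair (u , v) = ∈-cartesianProduct⁺ (∈-allFin u) (∈-allFin v)

-- Used to confine a class to a two-element set: `rev-class` and `bigon-component` each exhibit one
-- that is closed under the generating steps in both directions.
EqClosure-closed : ∀ {R : Rel A 0ℓ} (P : A → Set) →
  (∀ {x y} → R x y → P x → P y) → (∀ {x y} → R x y → P y → P x) →
  ∀ {x y} → EqClosure R x y → P x → P y
EqClosure-closed P f g ε             px = px
EqClosure-closed P f g (fwd r ◅ rs) px = EqClosure-closed P f g rs (f r px)
EqClosure-closed P f g (bwd r ◅ rs) px = EqClosure-closed P f g rs (g r px)

module _ {n} {G : Graph n} where

  ends : Dart G → Fin n × Fin n
  ends d = tail d , head d

  ends-injective : ∀ {d e : Dart G} → ends d ≡ ends e → d ≡ e
  ends-injective {dart u v p} {dart .u .v q} refl = cong (dart u v) (T-irrelevant p q)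

  rev-involutive : ∀ (d : Dart G) → rev (rev d) ≡ d
  rev-involutive d = ends-injective refl

  rev-class : ∀ {d e : Dart G} → EqClosure (Step rev) d e → e ≡ d ⊎ e ≡ rev d
  rev-class {d} p = EqClosure-closed (λ e → e ≡ d ⊎ e ≡ rev d) forth back p (inj₁ refl)
    where
    forth : ∀ {x y} → rev x ≡ y → x ≡ d ⊎ x ≡ rev d → y ≡ d ⊎ y ≡ rev d
    forth refl (inj₁ refl) = inj₂ refl
    forth refl (inj₂ refl) = inj₁ (rev-involutive d)
    back : ∀ {x y} → rev x ≡ y → y ≡ d ⊎ y ≡ rev d → x ≡ d ⊎ x ≡ rev d
    back {x} refl (inj₁ eq) = inj₂ (trans (sym (rev-involutive x)) (cong rev eq))
    back {x} refl (inj₂ eq) = inj₁ (trans (sym (rev-involutive x)) (trans (cong rev eq) (rev-involutive d)))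

  infix 4 _≟ᵈ_
  _≟ᵈ_ : ∀ (d e : Dart G) → Dec (d ≡ e)
  d ≟ᵈ e = map′ ends-injective (cong ends) (≡-dec Fin._≟_ Fin._≟_ (ends d) (ends e))

  -- Pairs are ordered, so each edge counts twice; bounds on numbers of edges appear doubled below.
  #pairs : (Fin n → Fin n → Bool) → ℕ
  #pairs r = ∑ (allFin n) λ u → ∑ (allFin n) λ v → ⟦ r u v ⟧

  pairs : (Fin n → Fin n → Bool) → List (Fin n × Fin n)
  pairs r = filter (λ (u , v) → T? (r u v)) (cartesianProduct (allFin n) (allFin n))

  length-pairs : ∀ r → length (pairs r) ≡ #pairs r
  length-pairs r = trans (length-filter-∑ (λ (u , v) → T? (r u v)) (cartesianProduct (allFin n) (allFin n)))
    (∑-cartesianProduct (λ (u , v) → ⟦ r u v ⟧) (allFin n) (allFin n))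

  pairs! : ∀ r → Unique (pairs r)
  pairs! r = Unique.filter⁺ _ (Unique.cartesianProduct⁺ (Unique.allFin⁺ n) (Unique.allFin⁺ n))

  ∈-pairs : ∀ {r u v} → T (r u v) → (u , v) ∈ pairs r
  ∈-pairs {r} {u} {v} t = ∈-filter⁺ (λ (u , v) → T? (r u v)) (∈-pair (u , v)) t

  open Graph G using (adj; adj-irrefl)

  module _ (ρ : Rotation G) (s : Fin n → Bool) where
    open Rotation ρ renaming (faceStep to φ)

    next-injective : ∀ {d e} → next d ≡ next e → d ≡ e
    next-injective = Injection.injective (Inverse⇒Injection perm)

    tail-φ : ∀ d → tail (φ d) ≡ head d
    tail-φ d = tail-next (rev d)

    φ-injective : ∀ {d e} → φ d ≡ φ e → d ≡ e
    φ-injective {d} {e} eq =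
      trans (sym (rev-involutive d)) (trans (cong rev (next-injective eq)) (rev-involutive e))

    -- A face of length one would be a loop.
    φ-nofix : ∀ d → ¬ φ d ≡ d
    φ-nofix d eq = adj-irrefl (trans (sym (cong tail eq)) (tail-φ d)) (Dart.edge d)

    module _ {d} (bigon : φ (φ d) ≡ d) where

      -- In a simple graph there is only one dart back from `head d` to `tail d`.
      bigon-φ : φ d ≡ rev d
      bigon-φ = ends-injective (cong₂ _,_ (tail-φ d) (trans (sym (tail-φ (φ d))) (cong tail bigon)))

      next-bigon : next d ≡ d
      next-bigon = trans (cong next (trans (sym (rev-involutive d)) (cong rev (sym bigon-φ)))) bigon

      -- `next` fixes both darts of the bigon and `rev` exchanges them, so both ends have degree one
      -- and the component is a single edge.
      bigon-component : ∀ {e} → EqClosure (λ x y → Step next x y ⊎ Step rev x y) d e → e ≡ d ⊎ e ≡ φ d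
      bigon-component p = EqClosure-closed (λ e → e ≡ d ⊎ e ≡ φ d) forth back p (inj₁ refl)
        where
        rev-φ : rev (φ d) ≡ d
        rev-φ = trans (cong rev bigon-φ) (rev-involutive d)
        next-φ : next (φ d) ≡ φ d
        next-φ = cong next bigon-φ
        forth : ∀ {x y} → next x ≡ y ⊎ rev x ≡ y → x ≡ d ⊎ x ≡ φ d → y ≡ d ⊎ y ≡ φ d
        forth (inj₁ refl) (inj₁ refl) = inj₁ next-bigon
        forth (inj₁ refl) (inj₂ refl) = inj₂ next-φ
        forth (inj₂ refl) (inj₁ refl) = inj₂ (sym bigon-φ)
        forth (inj₂ refl) (inj₂ refl) = inj₁ rev-φ
        back : ∀ {x y} → next x ≡ y ⊎ rev x ≡ y → y ≡ d ⊎ y ≡ φ d → x ≡ d ⊎ x ≡ φ d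
        back (inj₁ refl) (inj₁ eq) = inj₁ (next-injective (trans eq (sym next-bigon)))
        back (inj₁ refl) (inj₂ eq) = inj₂ (next-injective (trans eq (sym next-φ)))
        back {x} (inj₂ refl) (inj₁ eq) =
          inj₂ (trans (sym (rev-involutive x)) (trans (cong rev eq) (sym bigon-φ)))
        back {x} (inj₂ refl) (inj₂ eq) =
          inj₁ (trans (sym (rev-involutive x)) (trans (cong rev eq) rev-φ))

    cut mono : Fin n → Fin n → Bool
    cut  u v = adj u v ∧ (s u xor s v)
    mono u v = adj u v ∧ not (s u xor s v)

    #adj≡#cut+#mono : #pairs adj ≡ #pairs cut + #pairs mono
    #adj≡#cut+#mono = begin
      #pairs adj
        ≡⟨ ∑-cong (λ u → trans (∑-cong (λ v → split (adj u v) (s u xor s v)) V) (∑-+ _ _ V)) V ⟩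
      ∑ V (λ u → ∑ V (λ v → ⟦ cut u v ⟧) + ∑ V (λ v → ⟦ mono u v ⟧))
        ≡⟨ ∑-+ _ _ V ⟩
      #pairs cut + #pairs mono ∎
      where
      open ≡-Reasoning
      V = allFin n
      split : ∀ a b → ⟦ a ⟧ ≡ ⟦ a ∧ b ⟧ + ⟦ a ∧ not b ⟧
      split false _     = refl
      split true  true  = refl
      split true  false = refl

    mono-dart : ∀ (d : Dart G) → s (tail d) ≡ s (head d) → T (mono (tail d) (head d))
    mono-dart (dart u v p) eq with adj u v | s u | s v
    mono-dart (dart u v p) eq | true | true  | true  = _
    mono-dart (dart u v p) eq | true | false | false = _

    triangle-mono : ∀ d → φ (φ (φ d)) ≡ d →
      ∃ λ e → s (tail e) ≡ s (head e) × (e ≡ d ⊎ e ≡ φ d ⊎ e ≡ φ (φ d))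
    triangle-mono d eq with two (s (tail d)) (s (head d)) (s (head (φ d)))
      where
      two : ∀ a b c → a ≡ b ⊎ b ≡ c ⊎ c ≡ a
      two true  true  c     = inj₁ refl
      two true  false true  = inj₂ (inj₂ refl)
      two true  false false = inj₂ (inj₁ refl)
      two false true  true  = inj₂ (inj₁ refl)
      two false true  false = inj₂ (inj₂ refl)
      two false false c     = inj₁ refl
    ... | inj₁ a≡b        = d , a≡b , inj₁ refl
    ... | inj₂ (inj₁ b≡c) = φ d , trans (cong s (tail-φ d)) b≡c , inj₂ (inj₁ refl)
    -- The third side closes up: since `φ (φ (φ d)) ≡ d`, its head is the tail of `d`.
    ... | inj₂ (inj₂ c≡a) = φ (φ d) ,
      trans (cong s (tail-φ (φ d))) (trans c≡a (cong s (trans (sym (cong tail eq)) (tail-φ (φ (φ d)))))) ,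
      inj₂ (inj₂ refl)

    -- By `cyclic`, darts with the same tail form one class, so a class is determined by its tail.
    -- Isolated vertices carry no dart, hence an inequality.
    #vertices≤n : ∀ {k} → HasClasses (Step next) k → k ≤ n
    #vertices≤n bij = Fin.injective⇒≤ {f = tail ∘ to⁻} λ {i} {j} eq →
      trans (sym (to∘to⁻ i)) (trans (class-cong (cyclic _ _ eq)) (to∘to⁻ j))
      where open Bijection bij using (to⁻; surjection) renaming (cong to class-cong)
            open Surjection surjection using (to∘to⁻)

    -- A class consists of a dart and its reverse, so two pairs of ends for each class cover all
    -- adjacent pairs.
    #darts≤2*#edges : ∀ {k} → HasClasses (Step (rev {G = G})) k → #pairs adj ≤ 2 * k
    #darts≤2*#edges {k} bij = begin
      #pairs adj                           ≡⟨ length-pairs adj ⟨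
      length (pairs adj)                   ≤⟨ Unique⊆⇒length≤ (pairs! adj) sub ⟩
      length (concatMap both (allFin k))   ≡⟨ length-concatMap (λ _ → refl) (allFin k) ⟩
      length (allFin k) * 2                ≡⟨ cong (_* 2) (length-allFin k) ⟩
      k * 2                                ≡⟨ *-comm k 2 ⟩
      2 * k                                ∎
      where
      open ≤-Reasoning
      open Bijection bij using (to; to⁻; injective; surjection)
      open Surjection surjection using (to∘to⁻)
      both : Fin k → List (Fin n × Fin n)
      both i = ends (to⁻ i) ∷ ends (rev (to⁻ i)) ∷ []
      sub : pairs adj ⊆ concatMap both (allFin k)
      sub {u , v} uv∈ = ∈-concatMap⁺ both (Any.map found (∈-allFin (to d)))
        where
        d : Dart G
        d = dart u v (proj₂ (∈-filter⁻ (λ (u , v) → T? (adj u v)) {xs = cartesianProduct (allFin n) (allFin n)} uv∈))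
        found : ∀ {i} → to d ≡ i → (u , v) ∈ both i
        found refl with rev-class (injective (to∘to⁻ (to d)))
        ... | inj₁ d≡ = here (cong ends d≡)
        ... | inj₂ d≡ = there (here (cong ends d≡))

    module _ {F C} (faces : HasClasses (Step φ) F)
                   (components : HasClasses (λ x y → Step next x y ⊎ Step rev x y) C) where

      open Bijection faces using () renaming (to to face; to⁻ to corner; cong to face-cong; surjection to faces↠)
      open Bijection components using () renaming (to to component; injective to component-injective)
      open Surjection faces↠ using () renaming (to∘to⁻ to face-corner)

      face-φ : ∀ d → face (φ d) ≡ face d
      face-φ d = face-cong (bwd refl ◅ ε)

      -- A discharging scheme for 4F ≤ D + M + 2C, where D counts all darts and M the monochromatic
      -- ones: every face claims four slots and no slot is claimed by two faces. The three summands
      -- hold the darts, the monochromatic darts a second time, and two slots for each component.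
      Slot : Set
      Slot = Fin n × Fin n ⊎ Fin n × Fin n ⊎ Fin C × Bool

      bigons : List (Fin C × Bool)
      bigons = concatMap (λ c → (c , true) ∷ (c , false) ∷ []) (allFin C)

      slots : List Slot
      slots = map inj₁ (pairs adj) ++ map inj₂ (map inj₁ (pairs mono) ++ map inj₂ bigons)

      length-slots : length slots ≡ #pairs adj + (#pairs mono + C * 2)
      length-slots = begin
        length slots
          ≡⟨ trans (length-⊎ (pairs adj) _) (cong (length (pairs adj) +_) (length-⊎ (pairs mono) bigons)) ⟩
        length (pairs adj) + (length (pairs mono) + length bigons)
          ≡⟨ cong₂ _+_ (length-pairs adj) (cong₂ _+_ (length-pairs mono) length-bigons) ⟩
        #pairs adj + (#pairs mono + C * 2)                ∎
        where
        open ≡-Reasoning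
        length-bigons : length bigons ≡ C * 2
        length-bigons = trans (length-concatMap (λ _ → refl) (allFin C)) (cong (_* 2) (length-allFin C))

      data Owns (f : Fin F) : Slot → Set where
        side   : ∀ d → face d ≡ f → Owns f (inj₁ (ends d))
        chord  : ∀ d → face d ≡ f → s (tail d) ≡ s (head d) → Owns f (inj₂ (inj₁ (ends d)))
        bigon  : ∀ d b → face d ≡ f → φ (φ d) ≡ d → Owns f (inj₂ (inj₂ (component d , b)))

      -- A dart lies on one face only. A component slot also determines its face: a component with a
      -- bigon is a single edge, whose two darts lie on the same face.
      Owns-functional : ∀ {f g x y} → Owns f x → Owns g y → x ≡ y → f ≡ g
      Owns-functional (side d refl) (side e refl) eq = cong face (ends-injective (inj₁-injective eq))
      Owns-functional (chord d refl _) (chord e refl _) eq =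
        cong face (ends-injective (inj₁-injective (inj₂-injective eq)))
      Owns-functional (bigon d _ refl φφd) (bigon e _ refl _) eq
        with bigon-component φφd (component-injective (cong proj₁ (inj₂-injective (inj₂-injective eq))))
      ... | inj₁ refl = refl
      ... | inj₂ refl = sym (face-φ d)

      Owns⇒∈slots : ∀ {f x} → Owns f x → x ∈ slots
      Owns⇒∈slots (side d _) = ∈-++⁺ˡ (∈-map⁺ inj₁ (∈-pairs (Dart.edge d)))
      Owns⇒∈slots (chord d _ eq) = ∈-++⁺ʳ (map inj₁ (pairs adj)) (∈-map⁺ inj₂ (∈-++⁺ˡ (∈-map⁺ inj₁
        (∈-pairs {mono} (mono-dart d eq)))))
      Owns⇒∈slots (bigon d b _ _) = ∈-++⁺ʳ (map inj₁ (pairs adj)) (∈-map⁺ inj₂ (∈-++⁺ʳ (map inj₁ (pairs mono))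
        (∈-map⁺ inj₂ (∈-concatMap⁺ _ (Any.map (λ { refl → bool b }) (∈-allFin (component d)))))))
        where
        bool : ∀ b → (component d , b) ∈ (component d , true) ∷ (component d , false) ∷ []
        bool true  = here refl
        bool false = there (here refl)

      FourSlots : Fin F → Set
      FourSlots f = ∃ λ xs → Unique xs × length xs ≡ 4 × All (Owns f) xs

      -- A face of length at least four owns its sides, a triangle also one of its monochromatic
      -- sides, and a face of length two its component.
      fourSlots : ∀ f → FourSlots f
      fourSlots f = go (φ (φ d) ≟ᵈ d) (φ (φ (φ d)) ≟ᵈ d)
        where
        d = corner f
        f₀ : face d ≡ f
        f₀ = face-corner f
        f₁ : face (φ d) ≡ f
        f₁ = trans (face-φ d) f₀
        f₂ : face (φ (φ d)) ≡ f
        f₂ = trans (face-φ (φ d)) f₁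
        distinct : ∀ {x y : Dart G} → ¬ x ≡ y → ¬ inj₁ {B = Fin n × Fin n ⊎ Fin C × Bool} (ends x) ≡ inj₁ (ends y)
        distinct x≢y = x≢y ∘ ends-injective ∘ inj₁-injective
        ≢φ : ∀ x → ¬ x ≡ φ x
        ≢φ x = φ-nofix x ∘ sym
        go : Dec (φ (φ d) ≡ d) → Dec (φ (φ (φ d)) ≡ d) → FourSlots f
        go (yes φφd) _ =
          inj₁ (ends d) ∷ inj₁ (ends (φ d)) ∷ inj₂ (inj₂ (component d , true)) ∷ inj₂ (inj₂ (component d , false)) ∷ [] ,
          (distinct (≢φ d) ∷ (λ ()) ∷ (λ ()) ∷ []) ∷ ((λ ()) ∷ (λ ()) ∷ []) ∷ ((λ ()) ∷ []) ∷ [] ∷ [] ,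
          refl ,
          side d f₀ ∷ side (φ d) f₁ ∷ bigon d true f₀ φφd ∷ bigon d false f₀ φφd ∷ []
        go (no ¬φφd) (yes φφφd) with triangle-mono d φφφd
        ... | e , mono-e , e∈ =
          inj₁ (ends d) ∷ inj₁ (ends (φ d)) ∷ inj₁ (ends (φ (φ d))) ∷ inj₂ (inj₁ (ends e)) ∷ [] ,
          (distinct (≢φ d) ∷ distinct (¬φφd ∘ sym) ∷ (λ ()) ∷ []) ∷ (distinct (≢φ (φ d)) ∷ (λ ()) ∷ []) ∷ ((λ ()) ∷ []) ∷ [] ∷ [] ,
          refl ,
          side d f₀ ∷ side (φ d) f₁ ∷ side (φ (φ d)) f₂ ∷ chord e (face-e e∈) mono-e ∷ []
          where
          face-e : ∀ {e} → (e ≡ d ⊎ e ≡ φ d ⊎ e ≡ φ (φ d)) → face e ≡ f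
          face-e (inj₁ refl)        = f₀
          face-e (inj₂ (inj₁ refl)) = f₁
          face-e (inj₂ (inj₂ refl)) = f₂
        go (no ¬φφd) (no ¬φφφd) =
          inj₁ (ends d) ∷ inj₁ (ends (φ d)) ∷ inj₁ (ends (φ (φ d))) ∷ inj₁ (ends (φ (φ (φ d)))) ∷ [] ,
          (distinct (≢φ d) ∷ distinct (¬φφd ∘ sym) ∷ distinct (¬φφφd ∘ sym) ∷ []) ∷
          (distinct (≢φ (φ d)) ∷ distinct (¬φφd ∘ sym ∘ φ-injective) ∷ []) ∷
          (distinct (≢φ (φ (φ d))) ∷ []) ∷ [] ∷ [] ,
          refl ,
          side d f₀ ∷ side (φ d) f₁ ∷ side (φ (φ d)) f₂ ∷ side (φ (φ (φ d))) (trans (face-φ (φ (φ d))) f₂) ∷ []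

      4*#faces≤#slots : F * 4 ≤ #pairs adj + (#pairs mono + C * 2)
      4*#faces≤#slots = begin
        F * 4                                     ≡⟨ cong (_* 4) (length-allFin F) ⟨
        length (allFin F) * 4                     ≡⟨ length-concatMap (λ f → proj₁ (proj₂ (proj₂ (fourSlots f)))) (allFin F) ⟨
        length (concatMap owned (allFin F))       ≤⟨ Unique⊆⇒length≤ unique sub ⟩
        length slots                              ≡⟨ length-slots ⟩
        #pairs adj + (#pairs mono + C * 2)        ∎
        where
        open ≤-Reasoning
        owned : Fin F → List Slot
        owned f = proj₁ (fourSlots f)
        owns : ∀ {f x} → x ∈ owned f → Owns f x
        owns {f} = All.lookup (proj₂ (proj₂ (proj₂ (fourSlots f))))
        disjoint : ∀ {f g} → ¬ f ≡ g → Disjoint (owned f) (owned g)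
        disjoint f≢g (x∈f , x∈g) = f≢g (Owns-functional (owns x∈f) (owns x∈g) refl)
        unique : Unique (concatMap owned (allFin F))
        unique = Unique.concat⁺
          (All.map⁺ (All.tabulate λ {f} _ → proj₁ (proj₂ (fourSlots f))))
          (AllPairs.map⁺ (AllPairs.map disjoint (Unique.allFin⁺ F)))
        sub : concatMap owned (allFin F) ⊆ slots
        sub x∈ with Any.satisfied (∈-concatMap⁻ owned {xs = allFin F} x∈)
        ... | f , x∈f = Owns⇒∈slots (owns x∈f)

  -- Let `N` darts be split into `X` crossing and `M` monochromatic ones. Four times Euler's formula
  -- gives 4E + 8C = 4V + 4F ≤ 4n + N + M + 2C, while 4E ≥ 2N = N + X + M. What remains is X + 6C ≤
  -- 4n.
  #cut≤4*n : Planar G → ∀ (s : Fin n → Bool) → #pairs (λ u v → adj u v ∧ (s u xor s v)) ≤ 4 * n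
  #cut≤4*n (ρ , V , E , F , C , vs , es , fs , cs , euler) s =
    m+n≤o⇒m≤o _ (+-cancelʳ-≤ (N + (M + C * 2)) (X + 6 * C) (4 * n) (begin
      (X + 6 * C) + (N + (M + C * 2))  ≡⟨ lhs X M N C ⟩
      N + (X + M) + 8 * C              ≡⟨ cong (λ x → N + x + 8 * C) (#adj≡#cut+#mono ρ s) ⟨
      N + N + 8 * C                    ≤⟨ +-monoˡ-≤ (8 * C) (+-mono-≤ N≤2E N≤2E) ⟩
      2 * E + 2 * E + 8 * C            ≡⟨ four E C ⟩
      4 * (E + 2 * C)                  ≡⟨ cong (4 *_) euler ⟨
      4 * (V + F)                      ≡⟨ four′ V F ⟩
      4 * V + F * 4                    ≤⟨ +-mono-≤ (*-monoʳ-≤ 4 (#vertices≤n ρ s vs)) (4*#faces≤#slots ρ s fs cs) ⟩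
      4 * n + (N + (M + C * 2))        ∎))
    where
    open ≤-Reasoning
    N = #pairs adj
    X = #pairs (cut ρ s)
    M = #pairs (mono ρ s)
    N≤2E : N ≤ 2 * E
    N≤2E = #darts≤2*#edges ρ s es
    lhs : ∀ k m n c → (k + 6 * c) + (n + (m + c * 2)) ≡ n + (k + m) + 8 * c
    lhs = solve-∀
    four : ∀ e c → 2 * e + 2 * e + 8 * c ≡ 4 * (e + 2 * c)
    four = solve-∀
    four′ : ∀ v f → 4 * (v + f) ≡ 4 * v + f * 4
    four′ = solve-∀

-- Hamiltonian paths of the complement

T⇒1≤⟦⟧ : ∀ {b} → T b → 1 ≤ ⟦ b ⟧
T⇒1≤⟦⟧ {true} _ = ≤-refl

ʳ++-↭-++ : ∀ (xs ys : List A) → xs ʳ++ ys ↭ xs ++ ys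
ʳ++-↭-++ []       ys = ↭-refl
ʳ++-↭-++ (x ∷ xs) ys = ↭-trans (ʳ++-↭-++ xs (x ∷ ys)) (shift x xs ys)

module _ {n : ℕ} where
  open DecMembership (Fin._≟_ {n}) using (_∈?_)

  ∑-member : ∀ {S : List (Fin n)} → Unique S → ∑ (allFin n) (λ w → ⟦ does (w ∈? S) ⟧) ≡ length S
  ∑-member {S} S! = trans (sym (length-filter-∑ (_∈? S) (allFin n))) (≤-antisym
    (Unique⊆⇒length≤ (Unique.filter⁺ (_∈? S) (Unique.allFin⁺ n)) (proj₂ ∘ ∈-filter⁻ (_∈? S) {xs = allFin n}))
    (Unique⊆⇒length≤ S! (∈-filter⁺ (_∈? S) (∈-allFin _))))

  ∑-δ : ∀ (u : Fin n) → ∑ (allFin n) (λ w → ⟦ does (w Fin.≟ u) ⟧) ≡ 1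
  ∑-δ u = trans (∑-cong (λ w → cong ⟦_⟧ (∨false (does (w Fin.≟ u)))) (allFin n)) (∑-member ([] ∷ []))
    where
    ∨false : ∀ b → b ≡ b ∨ false
    ∨false true  = refl
    ∨false false = refl

deg : ∀ {n} → Graph n → Fin n → ℕ
deg {n} G u = ∑ (allFin n) λ v → ⟦ Graph.adj G u v ⟧

infix 4 _≼_
_≼_ : ∀ {n} → Graph n → Graph n → Set
H ≼ G = ∀ {u v} → Adj H u v → Adj G u v

Free : ∀ {n} → Graph n → Fin n → Fin n → Set
Free G u v = ¬ Adj G u v

Free-sym : ∀ {n} (G : Graph n) {u v} → Free G u v → Free G v u
Free-sym G ¬uv = ¬uv ∘ Graph.adj-sym G

-- `Free` also relates a vertex to itself; a permutation of `allFin n` has no repetitions, so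
-- consecutive vertices are distinct all the same.
CoHamiltonianPath : ∀ {n} → Graph n → Set
CoHamiltonianPath {n} G = ∃ λ ws → ws ↭ allFin n × Linked (Free G) ws

glue : ∀ {R : Rel A 0ℓ} → (∀ {x y} → R x y → R y x) → ∀ {x xs ys} →
  Linked R (x ∷ xs) → Linked R (x ∷ ys) → Linked R (xs ʳ++ x ∷ ys)
glue R-sym [-]      l = l
glue R-sym (r ∷ rs) l = glue R-sym rs (R-sym r ∷ l)

module _ {n} (G : Graph n) where
  open Graph G using (adj; adj-irrefl)

  private
    V = allFin n

    -- The closed neighbourhood of `u`.
    blocked : Fin n → Fin n → Bool
    blocked u w = does (w Fin.≟ u) ∨ adj u w

    unblocked : ∀ {u w} → ¬ T (blocked u w) → Free G u w
    unblocked {u} {w} ¬b uw = ¬b (Equivalence.from (T-∨ {does (w Fin.≟ u)}) (inj₂ uw))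

    self-blocked : ∀ u → T (blocked u u)
    self-blocked u rewrite dec-true (u Fin.≟ u) refl = _

    #blocked : List (Fin n) → Fin n → ℕ
    #blocked ws u = ∑ ws λ w → ⟦ blocked u w ⟧

    #blocked-V : ∀ u → #blocked V u ≡ suc (deg G u)
    #blocked-V u = begin
      #blocked V u                                                 ≡⟨ ∑-cong split V ⟩
      ∑ V (λ w → ⟦ does (w Fin.≟ u) ⟧ + ⟦ adj u w ⟧)               ≡⟨ ∑-+ _ _ V ⟩
      ∑ V (λ w → ⟦ does (w Fin.≟ u) ⟧) + deg G u                   ≡⟨ cong (_+ deg G u) (∑-δ u) ⟩
      suc (deg G u)                                                ∎
      where
      open ≡-Reasoning
      split : ∀ w → ⟦ blocked u w ⟧ ≡ ⟦ does (w Fin.≟ u) ⟧ + ⟦ adj u w ⟧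
      split w with w Fin.≟ u
      ... | no _ = refl
      ... | yes refl with adj u u in eq
      ...   | false = refl
      ...   | true  = contradiction (subst T (sym eq) _) (adj-irrefl refl)

  -- The chain is cut between two consecutive vertices b and a with b free from v and a free from u;
  -- the alternative counts, for every such pair, that b blocks v or a blocks u.
  crossover : ∀ {u v} x xs {ys} → Linked (Free G) (x ∷ xs) → Linked (Free G) (v ∷ ys) →
    (∃₂ λ bs as → xs ≡ bs ++ as × Linked (Free G) (x ∷ bs ++ v ∷ ys) × Linked (Free G) (u ∷ as))
    ⊎ suc (length xs) ≤ #blocked (x ∷ xs) v + #blocked xs u
  crossover {u} {v} x [] xs~ ys~ with T? (blocked v x)
  ... | no ¬vx = inj₁ ([] , [] , refl , Free-sym G (unblocked ¬vx) ∷ ys~ , [-])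
  ... | yes vx = inj₂ (≤-trans (T⇒1≤⟦⟧ vx) (≤-trans (m≤m+n _ _) (m≤m+n _ _)))
  crossover {u} {v} x (y ∷ xs) (x~y ∷ xs~) ys~ with T? (blocked v x) | T? (blocked u y)
  ... | no ¬vx | no ¬uy = inj₁ ([] , y ∷ xs , refl , Free-sym G (unblocked ¬vx) ∷ ys~ , unblocked ¬uy ∷ xs~)
  ... | yes vx | _      with crossover {u} y xs xs~ ys~
  ...   | inj₁ (bs , as , refl , p , q) = inj₁ (y ∷ bs , as , refl , x~y ∷ p , q)
  ...   | inj₂ h = inj₂ (begin
    suc (suc (length xs))                                           ≤⟨ +-mono-≤ (T⇒1≤⟦⟧ vx) h ⟩
    ⟦ blocked v x ⟧ + (#blocked (y ∷ xs) v + #blocked xs u)         ≡⟨ +-assoc ⟦ blocked v x ⟧ (#blocked (y ∷ xs) v) _ ⟨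
    #blocked (x ∷ y ∷ xs) v + #blocked xs u
      ≤⟨ +-monoʳ-≤ (#blocked (x ∷ y ∷ xs) v) (m≤n+m (#blocked xs u) ⟦ blocked u y ⟧) ⟩
    #blocked (x ∷ y ∷ xs) v + #blocked (y ∷ xs) u                   ∎)
    where open ≤-Reasoning
  crossover {u} {v} x (y ∷ xs) (x~y ∷ xs~) ys~ | no ¬vx | yes uy with crossover {u} y xs xs~ ys~
  ...   | inj₁ (bs , as , refl , p , q) = inj₁ (y ∷ bs , as , refl , x~y ∷ p , q)
  ...   | inj₂ h = inj₂ (begin
    suc (suc (length xs))                                           ≤⟨ +-mono-≤ (T⇒1≤⟦⟧ uy) h ⟩
    ⟦ blocked u y ⟧ + (#blocked (y ∷ xs) v + #blocked xs u)         ≡⟨ move ⟦ blocked u y ⟧ (#blocked (y ∷ xs) v) _ ⟩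
    #blocked (y ∷ xs) v + #blocked (y ∷ xs) u
      ≤⟨ +-monoˡ-≤ (#blocked (y ∷ xs) u) (m≤n+m (#blocked (y ∷ xs) v) ⟦ blocked v x ⟧) ⟩
    #blocked (x ∷ y ∷ xs) v + #blocked (y ∷ xs) u                   ∎)
    where
    open ≤-Reasoning
    move : ∀ a b c → a + (b + c) ≡ b + (a + c)
    move = solve-∀

  -- The segment `as` is reversed and put in front of `u`, while the other segment `u ∷ bs`
  -- continues with `v`.
  crossover-path : ∀ {u v xs ys bs as} → xs ≡ bs ++ as → Linked (Free G) (u ∷ bs ++ v ∷ ys) →
    Linked (Free G) (u ∷ as) → (u ∷ xs) ++ (v ∷ ys) ↭ V → CoHamiltonianPath G
  crossover-path {u} {v} {_} {ys} {bs} {as} refl p q cover =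
    as ʳ++ u ∷ bs ++ v ∷ ys , ↭-trans perm cover , glue (Free-sym G) q p
    where
    perm : as ʳ++ u ∷ bs ++ v ∷ ys ↭ u ∷ (bs ++ as) ++ v ∷ ys
    perm = ↭-trans (ʳ++-↭-++ as _) (↭-trans (shift u as _) (prep u
      (↭-trans (shifts as bs) (↭-reflexive (sym (++-assoc bs as _))))))

  -- Ore's counting argument. If neither chain can be cut, every position of both is charged to a
  -- vertex blocked by `u` or by `v`, which forces n ≤ deg u + deg v.
  join : ∀ {u v xs ys} → deg G u + deg G v < n →
    Linked (Free G) (u ∷ xs) → Linked (Free G) (v ∷ ys) → (u ∷ xs) ++ (v ∷ ys) ↭ V → CoHamiltonianPath G
  join {u} {v} {xs} {ys} small xs~ ys~ cover
    with crossover {u} {v} u xs xs~ ys~ | crossover {v} {u} v ys ys~ xs~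
  ... | inj₁ (_ , _ , eq , p , q) | _ = crossover-path eq p q cover
  ... | inj₂ _ | inj₁ (_ , _ , eq , p , q) = crossover-path eq p q (↭-trans (++-comm (v ∷ ys) (u ∷ xs)) cover)
  ... | inj₂ h | inj₂ k = contradiction small (≤⇒≯ (+-cancelʳ-≤ 2 n _ (begin
    n + 2
      ≡⟨ cong (_+ 2) (trans (sym (length-allFin n)) (trans (sym (↭-length cover)) (length-++ (u ∷ xs)))) ⟩
    suc (length xs) + suc (length ys) + 2
      -- Both `u` and `v` block themselves; these two terms restore the heads missing from
      -- `#blocked xs u` and `#blocked ys v`.
      ≤⟨ +-mono-≤ (+-mono-≤ h k) (+-mono-≤ (T⇒1≤⟦⟧ (self-blocked u)) (T⇒1≤⟦⟧ (self-blocked v))) ⟩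
    (#blocked (u ∷ xs) v + #blocked xs u) + (#blocked (v ∷ ys) u + #blocked ys v) + (⟦ blocked u u ⟧ + ⟦ blocked v v ⟧)
      ≡⟨ rearrange (#blocked (u ∷ xs) v) (#blocked xs u) (#blocked (v ∷ ys) u) (#blocked ys v) ⟦ blocked u u ⟧ _ ⟩
    (#blocked (u ∷ xs) u + #blocked (v ∷ ys) u) + (#blocked (u ∷ xs) v + #blocked (v ∷ ys) v)
      ≡⟨ cong₂ _+_ (total u) (total v) ⟩
    suc (deg G u) + suc (deg G v)
      ≡⟨ twice (deg G u) (deg G v) ⟩
    deg G u + deg G v + 2 ∎)))
    where
    open ≤-Reasoning
    total : ∀ w → #blocked (u ∷ xs) w + #blocked (v ∷ ys) w ≡ suc (deg G w)
    total w = trans (sym (∑-++ _ (u ∷ xs) (v ∷ ys))) (trans (∑-↭ _ cover) (#blocked-V w))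
    rearrange : ∀ a b c d e f → (a + b) + (c + d) + (e + f) ≡ ((e + b) + c) + (a + (f + d))
    rearrange = solve-∀
    twice : ∀ a b → suc a + suc b ≡ a + b + 2
    twice = solve-∀

-- Edge deletion and the Bondy-Chvátal closure

SamePair : ∀ {n} → Fin n → Fin n → Fin n → Fin n → Set
SamePair u v x y = (x ≡ u × y ≡ v) ⊎ (x ≡ v × y ≡ u)

samePair? : ∀ {n} (u v x y : Fin n) → Dec (SamePair u v x y)
samePair? u v x y = (x Fin.≟ u ×-dec y Fin.≟ v) ⊎-dec (x Fin.≟ v ×-dec y Fin.≟ u)

SamePair-sym : ∀ {n} {u v x y : Fin n} → SamePair u v x y → SamePair u v y x
SamePair-sym (inj₁ (p , q)) = inj₂ (q , p)
SamePair-sym (inj₂ (p , q)) = inj₁ (q , p)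

delete : ∀ {n} → Graph n → Fin n → Fin n → Graph n
delete G u v = record
  { adj        = λ x y → adj x y ∧ not ⌊ samePair? u v x y ⌋
  ; adj-sym    = λ {x} {y} xy → let e , ≢uv = Equivalence.to (T-∧ {adj x y}) xy in
                   Equivalence.from T-∧ (adj-sym e , fromWitnessFalse (toWitnessFalse ≢uv ∘ SamePair-sym))
  ; adj-irrefl = λ {x} {y} eq xy → adj-irrefl eq (proj₁ (Equivalence.to (T-∧ {adj x y}) xy))
  }
  where open Graph G

module _ {n} (G : Graph n) {u v : Fin n} where
  open Graph G using (adj)

  delete-≼ : delete G u v ≼ G
  delete-≼ {x} {y} = proj₁ ∘ Equivalence.to (T-∧ {adj x y})

  delete-Free : ∀ {x y} → Free (delete G u v) x y → Adj G x y → SamePair u v x y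
  delete-Free {x} {y} free xy = decidable-stable (samePair? u v x y)
    λ ≢uv → free (Equivalence.from T-∧ (xy , fromWitnessFalse ≢uv))

  #pairs-delete : Adj G u v → #pairs {G = G} (Graph.adj (delete G u v)) < #pairs {G = G} adj
  #pairs-delete uv = ∑-mono-< (λ x → ∑-mono (λ y → below (adj x y)) (allFin n)) (∈-allFin u)
    (∑-mono-< (λ y → below (adj u y)) (∈-allFin v)
      (strict uv (fromWitness {a? = samePair? u v u v} (inj₁ (refl , refl)))))
    where
    below : ∀ a {b} → ⟦ a ∧ b ⟧ ≤ ⟦ a ⟧
    below false         = z≤n
    below true  {false} = z≤n
    below true  {true}  = ≤-refl
    strict : ∀ {a b} → T a → T b → ⟦ a ∧ not b ⟧ < ⟦ a ⟧
    strict {true} {true} _ _ = ≤-refl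

  private
    -- The deleted edge has `x` as an end, so a chain that avoids `x` cannot use it.
    avoid : ∀ {x y} → SamePair u v x y → ∀ {ws} → All (x ≢_) ws →
      Linked (Free (delete G u v)) ws → Linked (Free G) ws
    avoid xy _ [] = []
    avoid xy _ [-] = [-]
    avoid xy (x≢a ∷ x≢b ∷ x∉) (r ∷ rs) =
      (λ ab → x≢ab (λ eq → x≢a (sym eq)) (λ eq → x≢b (sym eq)) xy (delete-Free r ab)) ∷ avoid xy (x≢b ∷ x∉) rs
      where
      x≢ab : ∀ {x y a b} → a ≢ x → b ≢ x → SamePair u v x y → ¬ SamePair u v a b
      x≢ab a≢ b≢ (inj₁ (refl , _)) (inj₁ (a≡u , _)) = a≢ a≡u
      x≢ab a≢ b≢ (inj₁ (refl , _)) (inj₂ (_ , b≡u)) = b≢ b≡u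
      x≢ab a≢ b≢ (inj₂ (refl , _)) (inj₁ (_ , b≡v)) = b≢ b≡v
      x≢ab a≢ b≢ (inj₂ (refl , _)) (inj₂ (a≡v , _)) = a≢ a≡v

    -- `done` is the part of the path before `x`, in reverse. The path visits `x` once, so it uses
    -- the deleted edge at most once; there it falls into two chains of `G`, headed by `x` and `y`,
    -- which `join` reconnects.
    repair : deg G u + deg G v < n → ∀ x done todo →
      Linked (Free G) (x ∷ done) → Linked (Free (delete G u v)) (x ∷ todo) →
      (x ∷ todo) ++ done ↭ allFin n → CoHamiltonianPath G
    repair small x done [] done~ _ cover = x ∷ done , cover , done~
    repair small x done (y ∷ todo) done~ (x~y ∷ todo~) cover with T? (adj x y)
    ... | no ¬xy = repair small y (x ∷ done) todo (Free-sym G ¬xy ∷ done~) todo~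
                     (↭-trans (shift x (y ∷ todo) done) cover)
    ... | yes xy with delete-Free x~y xy | Unique-↭ (↭-sym cover) (Unique.allFin⁺ n)
    ...   | same | x∉ ∷ _ = join G (small-xy same) done~
              (avoid same (All.++⁻ˡ (y ∷ todo) x∉) todo~)
              (↭-trans (prep x (++-comm done (y ∷ todo))) cover)
      where
      small-xy : ∀ {x y} → SamePair u v x y → deg G x + deg G y < n
      small-xy (inj₁ (refl , refl)) = small
      small-xy (inj₂ (refl , refl)) = subst (_< n) (+-comm (deg G u) _) small

  restore : deg G u + deg G v < n → CoHamiltonianPath (delete G u v) → CoHamiltonianPath G
  restore small ([] , cover , _)      = [] , cover , []
  restore small (w ∷ ws , cover , ws~) =
    repair small w [] ws [-] ws~ (↭-trans (↭-reflexive (++-identityʳ _)) cover)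

-- In the complement the degrees of `u` and `v` add up to 2(n - 1) minus this sum. Edges violating
-- the condition are thus those whose ends have complement degree sum at least n - 1, the threshold
-- at which a pair may be added to the complement.
Closed : ∀ {n} → Graph n → Set
Closed {n} G = ∀ u v → Adj G u v → n ≤ deg G u + deg G v

-- The Bondy–Chvátal closure for Hamiltonian paths of the complement.
closure : ∀ {n} (G : Graph n) → (∀ H → H ≼ G → Closed H → CoHamiltonianPath H) → CoHamiltonianPath G
closure {n} G closed⇒path = go G (<-wellFounded _) id
  where
  go : ∀ H → Acc _<_ (#pairs {G = H} (Graph.adj H)) → H ≼ G → CoHamiltonianPath H
  go H (acc rs) H≼G with Fin.any? (λ u → Fin.any? (λ v → T? (Graph.adj H u v) ×-dec (deg H u + deg H v <? n)))
  ... | yes (u , v , uv , small) =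
    restore H small (go (delete H u v) (rs (#pairs-delete H uv)) (H≼G ∘ delete-≼ H))
  ... | no none = closed⇒path H H≼G λ u v uv → ≮⇒≥ λ small → none (u , v , uv , small)

-- Vertices of large degree

Linked-universal : ∀ {R : A → A → Set} → (∀ x y → R x y) → ∀ xs → Linked R xs
Linked-universal r []           = []
Linked-universal r (x ∷ [])     = [-]
Linked-universal r (x ∷ y ∷ xs) = r x y ∷ Linked-universal r (y ∷ xs)

lookup-injective : ∀ {xs : List A} → Unique xs → ∀ {i j} → lookup xs i ≡ lookup xs j → i ≡ j
lookup-injective (_ ∷ _)     {zero}  {zero}  _  = refl
lookup-injective (x∉xs ∷ _)  {zero}  {suc j} eq = contradiction eq (All.lookup x∉xs (∈-lookup j))
lookup-injective (x∉xs ∷ _)  {suc i} {zero}  eq = contradiction (sym eq) (All.lookup x∉xs (∈-lookup i))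
lookup-injective (_ ∷ xs!)   {suc i} {suc j} eq = cong suc (lookup-injective xs! eq)

module _ {n} {G H : Graph n} (planar : Planar G) (H≼G : H ≼ G) where
  open DecMembership (Fin._≟_ {n}) using (_∈?_)
  private
    V = allFin n
    a = Graph.adj H

  module _ {S : List (Fin n)} (S! : Unique S) where
    private
      s : Fin n → Bool
      s u = does (u ∈? S)

      1ₛ : Fin n → ℕ
      1ₛ u = ⟦ s u ⟧

      h = length S

      -- Summed over all u and v this gives 2 Σ_S deg + 2h ≤ #cut + 2h², the terms with v = u
      -- accounting for the absence of loops.
      pointwise : ∀ u v → 1ₛ u * ⟦ a u v ⟧ + 1ₛ v * ⟦ a u v ⟧ + 2 * 1ₛ u * ⟦ does (v Fin.≟ u) ⟧ ≤
        ⟦ Graph.adj G u v ∧ (s u xor s v) ⟧ + 2 * 1ₛ u * 1ₛ v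
      pointwise u v with v Fin.≟ u
      ... | yes refl with a v v in eq
      ...   | true  = contradiction (subst T (sym eq) _) (Graph.adj-irrefl H refl)
      ...   | false with s v
      ...     | true  = m≤n+m 2 _
      ...     | false = z≤n
      pointwise u v | no v≢u with a u v in eq
      ...   | false with s u | s v
      ...     | true  | true  = z≤n
      ...     | true  | false = z≤n
      ...     | false | true  = z≤n
      ...     | false | false = z≤n
      pointwise u v | no v≢u | true with Graph.adj G u v | H≼G {u} {v} (subst T (sym eq) _)
      ...   | true | _ with s u | s v
      ...     | true  | true  = ≤-refl
      ...     | true  | false = ≤-refl
      ...     | false | true  = ≤-refl
      ...     | false | false = z≤n

      a-sym : ∀ u v → ⟦ a u v ⟧ ≡ ⟦ a v u ⟧
      a-sym u v with a u v in p | a v u in q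
      ... | true  | true  = refl
      ... | false | false = refl
      ... | true  | false = contradiction (Graph.adj-sym H {u} {v} (subst T (sym p) _)) (subst T q)
      ... | false | true  = contradiction (Graph.adj-sym H {v} {u} (subst T (sym q) _)) (subst T p)

      weight : ℕ
      weight = ∑ V λ u → 1ₛ u * deg H u

      ∑-left : ∑ V (λ u → ∑ V (λ v → 1ₛ u * ⟦ a u v ⟧ + 1ₛ v * ⟦ a u v ⟧ + 2 * 1ₛ u * ⟦ does (v Fin.≟ u) ⟧)) ≡ 2 * weight + 2 * h
      ∑-left = begin
        ∑ V (λ u → ∑ V (λ v → 1ₛ u * ⟦ a u v ⟧ + 1ₛ v * ⟦ a u v ⟧ + 2 * 1ₛ u * ⟦ does (v Fin.≟ u) ⟧))
          ≡⟨ ∑-cong (λ u → trans (∑-+ _ _ V) (cong₂ _+_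
               (trans (∑-+ _ _ V) (cong (_+ ∑ V (λ v → 1ₛ v * ⟦ a u v ⟧)) (∑-* (1ₛ u) (λ v → ⟦ a u v ⟧) V)))
               (trans (∑-* (2 * 1ₛ u) _ V) (trans (cong (2 * 1ₛ u *_) (∑-δ u)) (*-identityʳ _))))) V ⟩
        ∑ V (λ u → 1ₛ u * deg H u + ∑ V (λ v → 1ₛ v * ⟦ a u v ⟧) + 2 * 1ₛ u)
          ≡⟨ trans (∑-+ _ _ V) (cong₂ _+_ (∑-+ _ _ V) (∑-* 2 1ₛ V)) ⟩
        weight + ∑ V (λ u → ∑ V (λ v → 1ₛ v * ⟦ a u v ⟧)) + 2 * ∑ V 1ₛ
          ≡⟨ cong₂ (λ x y → weight + x + 2 * y) transposed (∑-member S!) ⟩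
        weight + weight + 2 * h
          ≡⟨ cong (_+ 2 * h) (cong (weight +_) (sym (+-identityʳ weight))) ⟩
        2 * weight + 2 * h ∎
        where
        open ≡-Reasoning
        transposed : ∑ V (λ u → ∑ V (λ v → 1ₛ v * ⟦ a u v ⟧)) ≡ weight
        transposed = trans (∑-comm (λ u v → 1ₛ v * ⟦ a u v ⟧) V V)
          (∑-cong (λ v → trans (∑-* (1ₛ v) (λ u → ⟦ a u v ⟧) V) (cong (1ₛ v *_) (∑-cong (λ u → a-sym u v) V))) V)

      ∑-right : ∑ V (λ u → ∑ V (λ v → ⟦ Graph.adj G u v ∧ (s u xor s v) ⟧ + 2 * 1ₛ u * 1ₛ v)) ≤ 4 * n + 2 * (h * h)
      ∑-right = begin
        ∑ V (λ u → ∑ V (λ v → ⟦ Graph.adj G u v ∧ (s u xor s v) ⟧ + 2 * 1ₛ u * 1ₛ v))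
          ≡⟨ ∑-cong (λ u → trans (∑-+ _ _ V) (cong (∑ V (λ v → ⟦ Graph.adj G u v ∧ (s u xor s v) ⟧) +_)
               (trans (∑-* (2 * 1ₛ u) 1ₛ V) (trans (cong (2 * 1ₛ u *_) (∑-member S!)) (swap* (1ₛ u) h))))) V ⟩
        ∑ V (λ u → ∑ V (λ v → ⟦ Graph.adj G u v ∧ (s u xor s v) ⟧) + 2 * h * 1ₛ u)
          ≡⟨ trans (∑-+ _ _ V) (cong (#pairs {G = G} (λ u v → Graph.adj G u v ∧ (s u xor s v)) +_)
               (trans (∑-* (2 * h) 1ₛ V) (trans (cong (2 * h *_) (∑-member S!)) (*-assoc 2 h h)))) ⟩
        #pairs {G = G} (λ u v → Graph.adj G u v ∧ (s u xor s v)) + 2 * (h * h)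
          ≤⟨ +-monoˡ-≤ (2 * (h * h)) (#cut≤4*n planar s) ⟩
        4 * n + 2 * (h * h) ∎
        where
        open ≤-Reasoning
        swap* : ∀ x y → 2 * x * y ≡ 2 * y * x
        swap* = solve-∀

    -- The degrees over `S` sum to at most h(h - 1) plus the number of edges of `G` leaving `S`,
    -- which is at most 2n. All is doubled, since cuts are counted by ordered pairs; letting `t`
    -- bound twice the degree also avoids halving n.
    degree-bound : ∀ {t} → All (λ u → t ≤ 2 * deg H u) S → h * t + 2 * h ≤ 4 * n + 2 * (h * h)
    degree-bound {t} t≤ = begin
      h * t + 2 * h          ≡⟨ cong (λ x → x * t + 2 * h) (∑-member S!) ⟨
      ∑ V 1ₛ * t + 2 * h     ≡⟨ cong (_+ 2 * h) (trans (*-comm (∑ V 1ₛ) t) (sym (∑-* t 1ₛ V))) ⟩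
      ∑ V (λ u → t * 1ₛ u) + 2 * h            ≤⟨ +-monoˡ-≤ (2 * h) (∑-mono t≤deg V) ⟩
      ∑ V (λ u → 2 * (1ₛ u * deg H u)) + 2 * h ≡⟨ cong (_+ 2 * h) (∑-* 2 _ V) ⟩
      2 * weight + 2 * h     ≡⟨ ∑-left ⟨
      ∑ V (λ u → ∑ V (λ v → 1ₛ u * ⟦ a u v ⟧ + 1ₛ v * ⟦ a u v ⟧ + 2 * 1ₛ u * ⟦ does (v Fin.≟ u) ⟧))
                             ≤⟨ ∑-mono (λ u → ∑-mono (pointwise u) V) V ⟩
      ∑ V (λ u → ∑ V (λ v → ⟦ Graph.adj G u v ∧ (s u xor s v) ⟧ + 2 * 1ₛ u * 1ₛ v))
                             ≤⟨ ∑-right ⟩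
      4 * n + 2 * (h * h)    ∎
      where
      open ≤-Reasoning
      t≤deg : ∀ u → t * 1ₛ u ≤ 2 * (1ₛ u * deg H u)
      t≤deg u with u ∈? S
      ... | yes u∈S = ≤-trans (≤-reflexive (*-identityʳ t))
        (≤-trans (All.lookup t≤ u∈S) (≤-reflexive (cong (2 *_) (sym (*-identityˡ (deg H u))))))
      ... | no _ = ≤-trans (≤-reflexive (*-zeroʳ t)) z≤n

-- The forbidden subgraphs

cast-injective : ∀ {m n} (eq : m ≡ n) {i j : Fin m} → cast eq i ≡ cast eq j → i ≡ j
cast-injective refl {i} {j} p = trans (sym (Fin.cast-is-id refl i)) (trans p (Fin.cast-is-id refl j))

-- Shows that two leaves share a part: once the earlier parts are stripped, `part` takes its values
-- in `Fin 1`.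
Fin1-trivial : ∀ (i j : Fin 1) → i ≡ j
Fin1-trivial zero zero = refl

module _ {n} (G : Graph n) where
  open Graph G using (adj-sym)

  embed : ∀ as (xs : List (Fin n)) (eq : sum as ≡ length xs) → Unique xs →
    (∀ i j → Adj (K as) i j → Adj G (lookup xs (cast eq i)) (lookup xs (cast eq j))) → K as ⊑ G
  embed as xs eq xs! hom = mk↣ {to = lookup xs ∘ cast eq} (cast-injective eq ∘ lookup-injective xs!) , hom

  complement : ∀ {xs : List (Fin n)} → Unique xs → ∃ λ ys → xs ++ ys ↭ allFin n × length ys ≡ n ∸ length xs
  complement {xs} xs! with Unique⊆⇒↭++ xs! (λ {x} _ → ∈-allFin x)
  ... | ys , p = ys , ↭-sym p , (begin
    length ys                                ≡⟨ m+n∸m≡n (length xs) (length ys) ⟨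
    length xs + length ys ∸ length xs
      ≡⟨ cong (_∸ length xs) (trans (sym (length-++ xs)) (trans (sym (↭-length p)) (length-allFin n))) ⟩
    n ∸ length xs                            ∎)
    where open ≡-Reasoning

  star⊑ : ∀ {a} → (∀ v → v ≢ a → Adj G a v) → K (1 ∷ (n ∸ 1) ∷ []) ⊑ G
  star⊑ {a} a~ with complement ([] ∷ [])
  ... | rest , perm , len with Unique-↭ (↭-sym perm) (Unique.allFin⁺ n)
  ...   | xs!@(a∉ ∷ _) = embed (1 ∷ (n ∸ 1) ∷ []) (a ∷ rest) (cong suc (trans (+-identityʳ _) (sym len))) xs! hom
    where
    leaf : ∀ i → Adj G a (lookup rest i)
    leaf i = a~ _ (λ eq → All.lookup a∉ (∈-lookup i) (sym eq))
    hom : ∀ i j → Adj (K (1 ∷ (n ∸ 1) ∷ [])) i j → _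
    hom zero    zero    ()
    hom zero    (suc j) _ = leaf _
    hom (suc i) zero    _ = adj-sym (leaf _)
    hom (suc i) (suc j) p = contradiction (cong suc (Fin1-trivial _ _)) (toWitnessFalse p)

  module _ {a b : Fin n} (a≢b : a ≢ b) where
    private
      ab! : Unique (a ∷ b ∷ [])
      ab! = (a≢b ∷ []) ∷ [] ∷ []

    biclique⊑ : (∀ v → v ≢ a → v ≢ b → Adj G a v × Adj G b v) → K (2 ∷ (n ∸ 2) ∷ []) ⊑ G
    biclique⊑ ab~ with complement ab!
    ... | rest , perm , len with Unique-↭ (↭-sym perm) (Unique.allFin⁺ n)
    ...   | xs!@((_ ∷ a∉) ∷ b∉ ∷ _) =
      embed (2 ∷ (n ∸ 2) ∷ []) (a ∷ b ∷ rest) (cong (2 +_) (trans (+-identityʳ _) (sym len))) xs! hom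
      where
      leaf : ∀ i → Adj G a (lookup rest i) × Adj G b (lookup rest i)
      leaf i = ab~ _ (≢-sym (All.lookup a∉ (∈-lookup i))) (≢-sym (All.lookup b∉ (∈-lookup i)))
      hom : ∀ i j → Adj (K (2 ∷ (n ∸ 2) ∷ [])) i j → _
      hom zero          zero          ()
      hom zero          (suc zero)    ()
      hom zero          (suc (suc j)) _ = proj₁ (leaf _)
      hom (suc zero)    zero          ()
      hom (suc zero)    (suc zero)    ()
      hom (suc zero)    (suc (suc j)) _ = proj₂ (leaf _)
      hom (suc (suc i)) zero          _ = adj-sym (proj₁ (leaf _))
      hom (suc (suc i)) (suc zero)    _ = adj-sym (proj₂ (leaf _))
      hom (suc (suc i)) (suc (suc j)) p = contradiction (cong suc (Fin1-trivial _ _)) (toWitnessFalse p)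

    book⊑ : ∀ {z} → z ≢ a → z ≢ b → Adj G a b →
      (∀ v → v ≢ a → v ≢ b → v ≢ z → Adj G a v × Adj G b v) → K (1 ∷ 1 ∷ (n ∸ 3) ∷ []) ⊑ G
    book⊑ {z} z≢a z≢b a~b ab~ with complement {z ∷ a ∷ b ∷ []} ((z≢a ∷ z≢b ∷ []) ∷ ab!)
    ... | rest , perm , len with Unique-↭ (↭-sym perm) (Unique.allFin⁺ n)
    ...   | (_ ∷ _ ∷ z∉) ∷ xs!@((_ ∷ a∉) ∷ b∉ ∷ _) =
      embed (1 ∷ 1 ∷ (n ∸ 3) ∷ []) (a ∷ b ∷ rest) (cong (2 +_) (trans (+-identityʳ _) (sym len))) xs! hom
      where
      leaf : ∀ i → Adj G a (lookup rest i) × Adj G b (lookup rest i)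
      leaf i = ab~ _ (≢-sym (All.lookup a∉ (∈-lookup i))) (≢-sym (All.lookup b∉ (∈-lookup i)))
        (≢-sym (All.lookup z∉ (∈-lookup i)))
      hom : ∀ i j → Adj (K (1 ∷ 1 ∷ (n ∸ 3) ∷ [])) i j → _
      hom zero          zero          ()
      hom zero          (suc zero)    _ = a~b
      hom zero          (suc (suc j)) _ = proj₁ (leaf _)
      hom (suc zero)    zero          _ = adj-sym a~b
      hom (suc zero)    (suc zero)    ()
      hom (suc zero)    (suc (suc j)) _ = proj₂ (leaf _)
      hom (suc (suc i)) zero          _ = adj-sym (proj₁ (leaf _))
      hom (suc (suc i)) (suc zero)    _ = adj-sym (proj₂ (leaf _))
      hom (suc (suc i)) (suc (suc j)) p = contradiction (cong suc (cong suc (Fin1-trivial _ _))) (toWitnessFalse p)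

  -- The colour of a vertex is its position on the path: colours at distance one belong to
  -- consecutive, hence non-adjacent, vertices.
  CoHamiltonianPath⇒DifferentialColoring : CoHamiltonianPath G → DifferentialColoring 2 G
  CoHamiltonianPath⇒DifferentialColoring (ws , perm , ws~) = mk⤖ (injective , surjective) , far
    where
    ws! : Unique ws
    ws! = Unique-↭ (↭-sym perm) (Unique.allFin⁺ n)

    len : length ws ≡ n
    len = trans (↭-length perm) (length-allFin n)

    ∈ws : ∀ v → v ∈ ws
    ∈ws v = ∈-resp-↭ (↭-sym perm) (∈-allFin v)

    index : Fin n → Fin (length ws)
    index v = Any.index (∈ws v)

    lookup-index′ : ∀ v → lookup ws (index v) ≡ v
    lookup-index′ v = sym (lookup-index (∈ws v))

    injective : ∀ {u v} → cast len (index u) ≡ cast len (index v) → u ≡ v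
    injective {u} {v} eq =
      trans (sym (lookup-index′ u)) (trans (cong (lookup ws) (cast-injective len eq)) (lookup-index′ v))

    surjective : ∀ i → ∃ λ v → ∀ {w} → w ≡ v → cast len (index w) ≡ i
    surjective i = lookup ws j , λ { refl → trans (cong (cast len) (lookup-injective ws! (lookup-index′ _)))
                                       (Fin.cast-involutive len (sym len) i) }
      where j = cast (sym len) i

    separated : ∀ {xs} → Linked (Free G) xs → ∀ i j → Adj G (lookup xs i) (lookup xs j) → 2 ≤ ∣ toℕ i - toℕ j ∣
    separated {_ ∷ _} _ zero          zero          p = contradiction p (Graph.adj-irrefl G refl)
    separated {_ ∷ _ ∷ _} (r ∷ _)  zero          (suc zero)    p = contradiction p r
    separated {_ ∷ _ ∷ _} (_ ∷ _)  zero          (suc (suc j)) p = s≤s (s≤s z≤n)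
    separated {_ ∷ _ ∷ _} (r ∷ _)  (suc zero)    zero          p = contradiction (adj-sym p) r
    separated {_ ∷ _ ∷ _} (_ ∷ _)  (suc (suc i)) zero          p = s≤s (s≤s z≤n)
    separated {_ ∷ _ ∷ _} (_ ∷ rs) (suc i)       (suc j)       p = separated rs i j p

    far : ∀ u v → Adj G u v → 2 ≤ ∣ toℕ (cast len (index u)) - toℕ (cast len (index v)) ∣
    far u v uv rewrite Fin.toℕ-cast len (index u) | Fin.toℕ-cast len (index v) =
      separated ws~ (index u) (index v) (subst₂ (Adj G) (sym (lookup-index′ u)) (sym (lookup-index′ v)) uv)

  -- Obstructions to a colouring

  module _ (coloring : DifferentialColoring 2 G) where
    private
      c = proj₁ coloring
      far = proj₂ coloring

      position : Fin n → ℕ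
      position v = toℕ (Bijection.to c v)

    -- In the complement a has degree at most one, so its only possible neighbour on the path is z.
    pendant : 3 ≤ n → ∀ a z → (∀ v → v ≢ a → v ≢ z → Adj G a v) →
      (position a ≡ 0 × position z ≡ 1) ⊎ (1 + position a ≡ n × 2 + position z ≡ n)
    pendant 3≤n a z a~ = go (position a) refl
      where
      next : ∀ γ → γ < n → ∣ γ - position a ∣ ≡ 1 → γ ≡ position z
      next γ γ<n dist with Bijection.strictlySurjective c (fromℕ< γ<n)
      ... | v , cv≡ with v Fin.≟ a | v Fin.≟ z
      ...   | yes refl | _        = contradiction
        (trans (sym (∣n-n∣≡0 (position a))) (trans (cong (∣_- position a ∣) position-v) dist)) (λ ())
        where
        position-v : position v ≡ γ
        position-v = trans (cong toℕ cv≡) (Fin.toℕ-fromℕ< γ<n)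
      ...   | no _     | yes refl = sym (trans (cong toℕ cv≡) (Fin.toℕ-fromℕ< γ<n))
      ...   | no v≢a   | no v≢z   = contradiction (far a v (a~ v v≢a v≢z)) (<⇒≱ (≤-reflexive (cong suc (begin
        ∣ position a - position v ∣   ≡⟨ ∣-∣-comm (position a) (position v) ⟩
        ∣ position v - position a ∣   ≡⟨ cong (∣_- position a ∣) (trans (cong toℕ cv≡) (Fin.toℕ-fromℕ< γ<n)) ⟩
        ∣ γ - position a ∣            ≡⟨ dist ⟩
        1                             ∎))))
        where open ≡-Reasoning

      go : ∀ α → position a ≡ α → (α ≡ 0 × position z ≡ 1) ⊎ (1 + α ≡ n × 2 + position z ≡ n)
      go zero    eq = inj₁ (refl , sym (next 1 (≤-trans (s≤s (s≤s z≤n)) 3≤n) (cong (∣ 1 -_∣) eq)))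
      go (suc α) eq with next α (≤-trans (n≤1+n _) α<n) (trans (cong (∣ α -_∣) eq) (dist α)) | suc (suc α) <? n
        where
        α<n : suc α < n
        α<n = subst (_< n) eq (Fin.toℕ<n (Bijection.to c a))
        dist : ∀ α → ∣ α - suc α ∣ ≡ 1
        dist zero    = refl
        dist (suc α) = dist α
      -- If there were a position on either side of `a`, both would be occupied by `z`.
      ... | α≡z | yes 2+α<n = contradiction
        (trans α≡z (sym (next (2 + α) 2+α<n (trans (cong (∣ 2 + α -_∣) eq) (dist (suc α))))))
        (<⇒≢ (s≤s (n≤1+n α)))
        where
        dist : ∀ α → ∣ suc α - α ∣ ≡ 1
        dist zero    = refl
        dist (suc α) = dist α
      ... | α≡z | no 2+α≮n = inj₂ (2+α≡n , trans (cong (2 +_) (sym α≡z)) 2+α≡n)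
        where
        2+α≡n : 2 + α ≡ n
        2+α≡n = ≤-antisym (subst (_< n) eq (Fin.toℕ<n (Bijection.to c a))) (≮⇒≥ 2+α≮n)

    -- With `z` taken to be `a` itself, `pendant` assigns two positions to `a`.
    ¬isolated : 3 ≤ n → ∀ a → ¬ (∀ v → v ≢ a → Adj G a v)
    ¬isolated 3≤n a a~ with pendant 3≤n a a (λ v v≢a _ → a~ v v≢a)
    ... | inj₁ (p , q) = contradiction (trans (sym p) q) (λ ())
    ... | inj₂ (p , q) = contradiction (trans p (sym q)) (<⇒≢ ≤-refl)

    -- Each of `a` and `b` would be an end of the path with the other one next to it, so the path
    -- would have only two vertices.
    ¬isolated-edge : 3 ≤ n → ∀ a b → ¬ (∀ v → v ≢ a → v ≢ b → Adj G a v × Adj G b v)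
    ¬isolated-edge 3≤n a b ab~ with pendant 3≤n a b (λ v v≢a v≢b → proj₁ (ab~ v v≢a v≢b))
                                  | pendant 3≤n b a (λ v v≢b v≢a → proj₂ (ab~ v v≢a v≢b))
    ... | inj₁ (a≡0 , b≡1) | inj₁ (b≡0 , _) = contradiction (trans (sym b≡1) b≡0) (λ ())
    ... | inj₁ (a≡0 , b≡1) | inj₂ (_ , p)   = contradiction (trans (cong (2 +_) (sym a≡0)) p) (<⇒≢ 3≤n)
    ... | inj₂ (_ , p)     | inj₁ (b≡0 , _) = contradiction (trans (cong (2 +_) (sym b≡0)) p) (<⇒≢ 3≤n)
    ... | inj₂ (p , q)     | inj₂ (r , t)   = contradiction (suc-injective (trans r (sym q))) (<⇒≢ ≤-refl)

    -- Both `a` and `b` would be ends of the path with `z` next to them, so the path would be a, z,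
    -- b and n would be 3.
    ¬twin-pendants : 4 ≤ n → ∀ a b z → a ≢ b → Adj G a b →
      ¬ (∀ v → v ≢ a → v ≢ b → v ≢ z → Adj G a v × Adj G b v)
    ¬twin-pendants 4≤n a b z a≢b a~b ab~ with pendant 3≤n a z a~ | pendant 3≤n b z b~
      where
      3≤n = ≤-trans (n≤1+n 3) 4≤n
      a~ : ∀ v → v ≢ a → v ≢ z → Adj G a v
      a~ v v≢a v≢z with v Fin.≟ b
      ... | yes refl = a~b
      ... | no v≢b   = proj₁ (ab~ v v≢a v≢b v≢z)
      b~ : ∀ v → v ≢ b → v ≢ z → Adj G b v
      b~ v v≢b v≢z with v Fin.≟ a
      ... | yes refl = adj-sym a~b
      ... | no v≢a   = proj₂ (ab~ v v≢a v≢b v≢z)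
    ... | inj₁ (p , _)   | inj₁ (q , _)   = a≢b (Bijection.injective c (Fin.toℕ-injective (trans p (sym q))))
    ... | inj₂ (p , _)   | inj₂ (q , _)   = a≢b (Bijection.injective c (Fin.toℕ-injective (suc-injective (trans p (sym q)))))
    ... | inj₁ (_ , z≡1) | inj₂ (_ , p)   = contradiction (trans (cong (2 +_) (sym z≡1)) p) (<⇒≢ 4≤n)
    ... | inj₂ (_ , p)   | inj₁ (_ , z≡1) = contradiction (trans (cong (2 +_) (sym z≡1)) p) (<⇒≢ 4≤n)

-- Injections missing at most one vertex

extend : ∀ {m n} (f : Fin m ↣ Fin n) v → ¬ (∃ λ j → Injection.to f j ≡ v) → Fin (suc m) ↣ Fin n
extend {m} {n} f v v∉f = mk↣ {to = g} g-injective
  where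
  open Injection f using (to; injective)
  g : Fin (suc m) → Fin n
  g zero    = v
  g (suc j) = to j
  g-injective : ∀ {i j} → g i ≡ g j → i ≡ j
  g-injective {zero}  {zero}  _  = refl
  g-injective {zero}  {suc j} eq = contradiction (j , sym eq) v∉f
  g-injective {suc i} {zero}  eq = contradiction (i , eq) v∉f
  g-injective {suc i} {suc j} eq = cong suc (injective eq)

preimage : ∀ {m n} (f : Fin m ↣ Fin n) → n ≤ m → ∀ v → ∃ λ j → Injection.to f j ≡ v
preimage f n≤m v with Fin.any? (λ j → Injection.to f j Fin.≟ v)
... | yes found = found
... | no v∉f    = contradiction (Fin.injective⇒≤ (Injection.injective (extend f v v∉f))) (<⇒≱ (s≤s n≤m))

-- Adding a missed `z` to the injection makes it surjective by `preimage`. If nothing is missed, any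
-- vertex will do, and `default` is taken.
preimage-but-one : ∀ {m n} (f : Fin m ↣ Fin n) → n ≤ suc m → Fin n →
  ∃ λ z → ∀ v → v ≢ z → ∃ λ j → Injection.to f j ≡ v
preimage-but-one f n≤1+m default with Fin.any? (λ z → ¬? (Fin.any? (λ j → Injection.to f j Fin.≟ z)))
... | no all = default , λ v _ → decidable-stable (Fin.any? (λ j → Injection.to f j Fin.≟ v)) (λ v∉f → all (v , v∉f))
... | yes (z , z∉f) = z , λ v v≢z → found v≢z (preimage (extend f z z∉f) n≤1+m v)
  where
  found : ∀ {v} → v ≢ z → ∃ (λ j → Injection.to (extend f z z∉f) j ≡ v) → ∃ λ j → Injection.to f j ≡ v
  found v≢z (zero  , z≡v) = contradiction (sym z≡v) v≢z
  found v≢z (suc j , eq)  = j , eq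

module _ {n} (G : Graph n) (n≥4 : 4 ≤ n) (coloring : DifferentialColoring 2 G) where
  private
    n≥3 : 3 ≤ n
    n≥3 = ≤-trans (n≤1+n 3) n≥4

    -- The final `0` comes from `sum`. With `k` equal to 1 or 2 the right-hand side is the order of
    -- the star or of the biclique; with 3 it is one more than the order of K_{1,1,n-3}, as
    -- `preimage-but-one` requires.
    large : ∀ k → n ≤ k + (n ∸ k + 0)
    large k = ≤-trans (m≤n+m∸n n k) (≤-reflexive (cong (k +_) (sym (+-identityʳ (n ∸ k)))))

  star⋢ : ¬ (K (1 ∷ (n ∸ 1) ∷ []) ⊑ G)
  star⋢ (f , hom) = ¬isolated G coloring n≥3 (to zero) a~
    where
    open Injection f using (to)
    a~ : ∀ v → v ≢ to zero → Adj G (to zero) v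
    a~ v v≢a with preimage f (large 1) v
    ... | zero  , refl = contradiction refl v≢a
    ... | suc j , refl = hom zero (suc j) _

  biclique⋢ : ¬ (K (2 ∷ (n ∸ 2) ∷ []) ⊑ G)
  biclique⋢ (f , hom) = ¬isolated-edge G coloring n≥3 (to zero) (to (suc zero)) ab~
    where
    open Injection f using (to)
    ab~ : ∀ v → v ≢ to zero → v ≢ to (suc zero) → Adj G (to zero) v × Adj G (to (suc zero)) v
    ab~ v v≢a v≢b with preimage f (large 2) v
    ... | zero        , refl = contradiction refl v≢a
    ... | suc zero    , refl = contradiction refl v≢b
    ... | suc (suc j) , refl = hom zero (suc (suc j)) _ , hom (suc zero) (suc (suc j)) _

  book⋢ : ¬ (K (1 ∷ 1 ∷ (n ∸ 3) ∷ []) ⊑ G)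
  book⋢ (f , hom) with preimage-but-one f (large 3) (Injection.to f zero)
  ... | z , found = ¬twin-pendants G coloring n≥4 (to zero) (to (suc zero)) z
      (λ eq → Fin.0≢1+n (injective eq)) (hom zero (suc zero) _) ab~
    where
    open Injection f using (to; injective)
    ab~ : ∀ v → v ≢ to zero → v ≢ to (suc zero) → v ≢ z → Adj G (to zero) v × Adj G (to (suc zero)) v
    ab~ v v≢a v≢b v≢z with found v v≢z
    ... | zero        , refl = contradiction refl v≢a
    ... | suc zero    , refl = contradiction refl v≢b
    ... | suc (suc j) , refl = hom zero (suc (suc j)) _ , hom (suc zero) (suc (suc j)) _

-- Closed graphs

module _ {n} {G H : Graph n} (n≥36 : 36 ≤ n) (planar : Planar G) (H≼G : H ≼ G) (closed : Closed H)
         (¬book : ¬ (K (1 ∷ 1 ∷ (n ∸ 3) ∷ []) ⊑ G))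
         (¬star : ¬ (K (1 ∷ (n ∸ 1) ∷ []) ⊑ G))
         (¬biclique : ¬ (K (2 ∷ (n ∸ 2) ∷ []) ⊑ G)) where

  private
    V = allFin n
    adj = Graph.adj H

    Heavy : Fin n → Set
    Heavy u = n ≤ 2 * deg H u

    heavy? : ∀ u → Dec (Heavy u)
    heavy? u = n ≤? 2 * deg H u

    hs : List (Fin n)
    hs = filter heavy? V

    hs! : Unique hs
    hs! = Unique.filter⁺ heavy? (Unique.allFin⁺ n)

    hs-Heavy : ∀ {u} → u ∈ hs → Heavy u
    hs-Heavy = proj₂ ∘ ∈-filter⁻ heavy? {xs = V}

    Heavy-hs : ∀ {u} → Heavy u → u ∈ hs
    Heavy-hs = ∈-filter⁺ heavy? (∈-allFin _)

    edge-Heavy : ∀ {u v} → Adj H u v → ¬ Heavy v → Heavy u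
    edge-Heavy {u} {v} uv ¬hv with heavy? u
    ... | yes hu = hu
    ... | no ¬hu = contradiction (closed u v uv) (<⇒≱ (*-cancelˡ-< 2 _ _ (begin-strict
      2 * (deg H u + deg H v)      ≡⟨ *-distribˡ-+ 2 (deg H u) _ ⟩
      2 * deg H u + 2 * deg H v    <⟨ +-mono-< (≰⇒> ¬hu) (≰⇒> ¬hv) ⟩
      n + n                        ≡⟨ cong (n +_) (+-identityʳ n) ⟨
      2 * n                        ∎)))
      where open ≤-Reasoning

    few-neighbours : ∀ v → (∀ w → Adj H v w → Heavy w) → deg H v ≤ length hs
    few-neighbours v heavy-nbrs = ≤-trans (∑-mono pointwise V) (≤-reflexive (sym (length-filter-∑ heavy? V)))
      where
      pointwise : ∀ w → ⟦ adj v w ⟧ ≤ ⟦ does (heavy? w) ⟧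
      pointwise w with adj v w in eq
      ... | false = z≤n
      ... | true rewrite dec-true (heavy? w) (heavy-nbrs w (subst T (sym eq) _)) = ≤-refl

    -- The square in `degree-bound` makes it useless for long lists, so it is applied to just `k` of
    -- the heavy vertices.
    prefix : ∀ k → k ≤ length hs → ∀ {t} → (∀ u → Heavy u → t ≤ 2 * deg H u) →
      k * t + 2 * k ≤ 4 * n + 2 * (k * k)
    prefix k k≤ {t} t≤ = subst (λ k → k * t + 2 * k ≤ 4 * n + 2 * (k * k))
      (trans (length-take k hs) (m≤n⇒m⊓n≡m k≤))
      (degree-bound {G = G} {H = H} planar H≼G (Unique.take⁺ k hs!)
        (All.take⁺ k (All.tabulate (λ {u} u∈ → t≤ u (hs-Heavy u∈)))))

    #hs≤5 : length hs ≤ 5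
    -- Six heavy vertices with t = n give 6n + 12 ≤ 4n + 72, hence 84 ≤ 72 for n ≥ 36, which `≤⇒≤ᵇ`
    -- turns into an element of the empty type.
    #hs≤5 = ≮⇒≥ λ 6≤ → ≤⇒≤ᵇ (begin
      2 * 36 + 12       ≤⟨ +-monoˡ-≤ 12 (*-monoʳ-≤ 2 n≥36) ⟩
      2 * n + 12        ≤⟨ +-cancelˡ-≤ (4 * n) _ _ (subst (_≤ 4 * n + 72) (split n) (prefix 6 6≤ (λ _ h → h))) ⟩
      72                ∎)
      where
      open ≤-Reasoning
      split : ∀ n → 6 * n + 12 ≡ 4 * n + (2 * n + 12)
      split = solve-∀

    -- A heavy vertex has degree at least 18, and at most five of its neighbours are heavy.
    light-neighbour : ∀ {a} → Heavy a → ∃ λ w → Adj H a w × ¬ Heavy w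
    light-neighbour {a} ha with Fin.any? (λ w → T? (adj a w) ×-dec ¬? (heavy? w))
    ... | yes found = found
    ... | no none = contradiction (≤-trans n≥36 (≤-trans ha (*-monoʳ-≤ 2 (≤-trans (few-neighbours a all-heavy) #hs≤5))))
                      (<⇒≱ (s≤s (m≤m+n 10 25)))
      where
      all-heavy : ∀ w → Adj H a w → Heavy w
      all-heavy w aw = decidable-stable (heavy? w) (λ ¬hw → none (w , aw , ¬hw))

    -- All neighbours of a light neighbour `w` are heavy, so `w` has degree at most `length hs`. The
    -- bound is kept in this form because it is used again, more sharply, when `hs` is known to be
    -- shorter.
    large-degree : ∀ {a} → Heavy a → n ≤ deg H a + length hs
    large-degree {a} ha with light-neighbour ha
    ... | w , aw , ¬hw = ≤-trans (closed a w aw) (+-monoʳ-≤ (deg H a)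
      (few-neighbours w (λ x wx → edge-Heavy (Graph.adj-sym H wx) ¬hw)))

    #hs≤2 : length hs ≤ 2
    -- Heavy degrees are now at least r = n - 5 ≥ 31. Three heavy vertices with t = 2r give 6r + 6 ≤
    -- 4(r + 5) + 18, that is 2r + 6 ≤ 38, against 2r + 6 ≥ 68.
    #hs≤2 = ≮⇒≥ λ 3≤ → ≤⇒≤ᵇ (begin
      2 * 31 + 6        ≤⟨ +-monoˡ-≤ 6 (*-monoʳ-≤ 2 (∸-monoˡ-≤ 5 n≥36)) ⟩
      2 * r + 6         ≤⟨ +-cancelˡ-≤ (4 * r) _ _ (subst₂ _≤_ (split r) (trans (cong (λ n → 4 * n + 18) n≡5+r) (split′ r))
                             (prefix 3 3≤ (λ u hu → *-monoʳ-≤ 2 (r≤ hu)))) ⟩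
      38                ∎)
      where
      open ≤-Reasoning
      r = n ∸ 5
      n≡5+r : n ≡ 5 + r
      n≡5+r = sym (m+[n∸m]≡n (≤-trans (m≤m+n 5 31) n≥36))
      r≤ : ∀ {u} → Heavy u → r ≤ deg H u
      r≤ {u} hu = m≤n+o⇒m∸n≤o n 5 (begin
        n                        ≤⟨ large-degree hu ⟩
        deg H u + length hs      ≤⟨ +-monoʳ-≤ (deg H u) #hs≤5 ⟩
        deg H u + 5              ≡⟨ +-comm (deg H u) 5 ⟩
        5 + deg H u              ∎)
      split : ∀ r → 3 * (2 * r) + 6 ≡ 4 * r + (2 * r + 6)
      split = solve-∀
      split′ : ∀ r → 4 * (5 + r) + 18 ≡ 4 * r + 38
      split′ = solve-∀

    non-neighbours : ∀ {a} {S : List (Fin n)} → Unique S → All (Free H a) S → length S + deg H a ≤ n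
    non-neighbours {a} {S} S! free = begin
      length S + deg H a                                       ≡⟨ cong (_+ deg H a) (∑-member S!) ⟨
      ∑ V (λ w → ⟦ does (w ∈? S) ⟧) + deg H a                  ≡⟨ ∑-+ _ _ V ⟨
      ∑ V (λ w → ⟦ does (w ∈? S) ⟧ + ⟦ adj a w ⟧)              ≤⟨ ∑-mono pointwise V ⟩
      ∑ V (λ _ → 1)                                            ≡⟨ ∑-const 1 V ⟩
      length V * 1                                             ≡⟨ *-identityʳ (length V) ⟩
      length V                                                 ≡⟨ length-allFin n ⟩
      n                                                        ∎
      where
      open ≤-Reasoning
      open DecMembership (Fin._≟_ {n}) using (_∈?_)
      pointwise : ∀ w → ⟦ does (w ∈? S) ⟧ + ⟦ adj a w ⟧ ≤ 1
      pointwise w with w ∈? S | adj a w in eq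
      ... | no _    | false = z≤n
      ... | no _    | true  = ≤-refl
      ... | yes _   | false = ≤-refl
      ... | yes w∈S | true  = contradiction (subst T (sym eq) _) (All.lookup free w∈S)

    Free-refl : ∀ a → Free H a a
    Free-refl a = Graph.adj-irrefl H refl

    -- S already exhausts the k non-neighbours that a vertex of degree n - k can have.
    adjacent : ∀ {a k v} {S : List (Fin n)} → n ≤ deg H a + k → length S ≡ k → Unique S → All (Free H a) S →
      All (v ≢_) S → Adj H a v
    adjacent {a} {k} {v} {S} big refl S! free v∉ = decidable-stable (T? (adj a v)) λ ¬av →
      contradiction (≤-trans (non-neighbours (v∉ ∷ S!) (¬av ∷ free)) big)
        (<⇒≱ (≤-reflexive (cong suc (+-comm (deg H a) (length S)))))

    module TwoHeavy {a b} (hs≡ : hs ≡ a ∷ b ∷ []) where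
      heavy⇒ab : ∀ {v} → Heavy v → v ≡ a ⊎ v ≡ b
      heavy⇒ab {v} hv with subst (v ∈_) hs≡ (Heavy-hs hv)
      ... | here v≡a         = inj₁ v≡a
      ... | there (here v≡b) = inj₂ v≡b

      a≢b : a ≢ b
      a≢b with subst Unique hs≡ hs!
      ... | (a≢b ∷ []) ∷ _ = a≢b

      Light : Fin n → Set
      Light v = v ≢ a × v ≢ b

      light-Free : ∀ {u v} → Light u → Light v → Free H u v
      light-Free (u≢a , u≢b) (v≢a , v≢b) uv with heavy⇒ab (edge-Heavy uv (λ hv → case-v (heavy⇒ab hv)))
        where
        case-v : _ → _
        case-v (inj₁ v≡a) = v≢a v≡a
        case-v (inj₂ v≡b) = v≢b v≡b
      ... | inj₁ u≡a = u≢a u≡a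
      ... | inj₂ u≡b = u≢b u≡b

      big : ∀ {c} → c ∈ a ∷ b ∷ [] → n ≤ deg H c + 2
      big {c} c∈ = subst (λ k → n ≤ deg H c + k) (cong length hs≡) (large-degree (hs-Heavy (subst (c ∈_) (sym hs≡) c∈)))

      big-a : n ≤ deg H a + 2
      big-a = big (here refl)

      big-b : n ≤ deg H b + 2
      big-b = big (there (here refl))

      -- Light vertices may follow one another in any order; only the last step, to `b`, needs a
      -- chosen non-neighbour.
      spread : ∀ {x y zs} → Light x → All Light zs → Light y → Free H y b → Linked (Free H) (x ∷ zs ++ y ∷ b ∷ [])
      spread lx []         ly yb = light-Free lx ly ∷ yb ∷ [-]
      spread lx (lz ∷ lzs) ly yb = light-Free lx lz ∷ spread lz lzs ly yb

      -- As `a` and `b` are adjacent, `a′` is not `b` and `b′` is not `a`; hence both are light, and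
      -- `spread` links them through all the other vertices.
      path : Adj H a b → ∀ {a′ b′} → a′ ≢ a → Free H a a′ → b′ ≢ b → Free H b b′ → a′ ≢ b′ → CoHamiltonianPath H
      path ab {a′} {b′} a′≢a aa′ b′≢b bb′ a′≢b′
        with complement H {xs = b ∷ b′ ∷ a ∷ a′ ∷ []}
               ((≢-sym b′≢b ∷ ≢-sym a≢b ∷ b≢a′ ∷ []) ∷ (b′≢a ∷ ≢-sym a′≢b′ ∷ []) ∷ (≢-sym a′≢a ∷ []) ∷ [] ∷ [])
        where
        b≢a′ : b ≢ a′
        b≢a′ refl = aa′ ab
        b′≢a : b′ ≢ a
        b′≢a refl = bb′ (Graph.adj-sym H ab)
      ... | rest , perm , _ with Unique-↭ (↭-sym perm) (Unique.allFin⁺ n)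
      ...   | (_ ∷ _ ∷ b≢a′ ∷ b∉) ∷ (b′≢a ∷ _) ∷ (_ ∷ a∉) ∷ _ =
        a ∷ a′ ∷ rest ++ b′ ∷ b ∷ [] , ↭-trans reorder perm ,
        aa′ ∷ spread (a′≢a , ≢-sym b≢a′)
                (All.zipWith (λ (a≢ , b≢) → ≢-sym a≢ , ≢-sym b≢) (a∉ , b∉))
                (b′≢a , b′≢b) (Free-sym H bb′)
        where
        reorder : a ∷ a′ ∷ rest ++ b′ ∷ b ∷ [] ↭ b ∷ b′ ∷ a ∷ a′ ∷ rest
        reorder = ↭-trans (++-comm (a ∷ a′ ∷ rest) (b′ ∷ b ∷ [])) (swap b′ b ↭-refl)

      -- Degrees are at least n - 2, so `a` and `b` have at most one non-neighbour each apart from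
      -- themselves. If it is the other one of the two, K_{2,n-2} arises; if one of them has none, a
      -- star; if both have the same one, K_{1,1,n-3}. Otherwise `path` applies.
      result : CoHamiltonianPath H
      result with T? (adj a b)
      ... | no ¬ab = contradiction (biclique⊑ G a≢b (λ v v≢a v≢b →
              H≼G (adjacent big-a refl ((a≢b ∷ []) ∷ [] ∷ []) (Free-refl a ∷ ¬ab ∷ []) (v≢a ∷ v≢b ∷ [])) ,
              H≼G (adjacent big-b refl ((≢-sym a≢b ∷ []) ∷ [] ∷ []) (Free-refl b ∷ Free-sym H ¬ab ∷ []) (v≢b ∷ v≢a ∷ []))))
              ¬biclique
      ... | yes ab with non-neighbour a | non-neighbour b
        where
        non-neighbour : ∀ c → ∃ λ c′ → c′ ≢ c × Free H c c′
        non-neighbour c with Fin.any? (λ v → ¬? (v Fin.≟ c) ×-dec ¬? (T? (adj c v)))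
        ... | yes found = found
        ... | no none = contradiction (star⊑ G (λ v v≢c →
                H≼G (decidable-stable (T? (adj c v)) (λ ¬cv → none (v , v≢c , ¬cv))))) ¬star
      ...   | a′ , a′≢a , aa′ | b′ , b′≢b , bb′ with a′ Fin.≟ b′
      ...     | no a′≢b′ = path ab a′≢a aa′ b′≢b bb′ a′≢b′
      ...     | yes refl = contradiction (book⊑ G a≢b a′≢a b′≢b (H≼G ab) (λ v v≢a v≢b v≢z →
              H≼G (adjacent big-a refl ((≢-sym a′≢a ∷ []) ∷ [] ∷ []) (Free-refl a ∷ aa′ ∷ []) (v≢a ∷ v≢z ∷ [])) ,
              H≼G (adjacent big-b refl ((≢-sym b′≢b ∷ []) ∷ [] ∷ []) (Free-refl b ∷ bb′ ∷ []) (v≢b ∷ v≢z ∷ []))))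
              ¬book

  closed⇒CoHamiltonianPath : CoHamiltonianPath H
  closed⇒CoHamiltonianPath = cases hs refl #hs≤2
    where
    cases : ∀ xs → hs ≡ xs → length xs ≤ 2 → CoHamiltonianPath H
    -- Every edge has a heavy end, so `H` has no edges and any order of the vertices works.
    cases [] eq _ = V , ↭-refl , Linked-universal edgeless V
      where
      light : ∀ {v} → ¬ Heavy v
      light {v} hv with subst (v ∈_) eq (Heavy-hs hv)
      ... | ()
      edgeless : ∀ u v → Free H u v
      edgeless u v uv = light (edge-Heavy uv light)
    -- Here `large-degree` gives `a` degree at least n - 1, which makes it the centre of a star.
    cases (a ∷ []) eq _ = contradiction (star⊑ G (λ v v≢a →
          H≼G (adjacent big refl ([] ∷ []) (Free-refl a ∷ []) (v≢a ∷ [])))) ¬star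
      where
      big : n ≤ deg H a + 1
      big = subst (λ k → n ≤ deg H a + k) (cong length eq) (large-degree (hs-Heavy (subst (a ∈_) (sym eq) (here refl))))
    cases (a ∷ b ∷ []) eq _ = TwoHeavy.result eq
    cases (_ ∷ _ ∷ _ ∷ _) _ (s≤s (s≤s ()))

theorem3 : ∀ (n : ℕ) (G : Graph n) → 36 ≤ n → Planar G →
    DifferentialColoring 2 G ⇔
    ( ¬ (K (1 ∷ 1 ∷ (n ∸ 3) ∷ []) ⊑ G)
    × ¬ (K (1 ∷ (n ∸ 1) ∷ []) ⊑ G)
    × ¬ (K (2 ∷ (n ∸ 2) ∷ []) ⊑ G) )
theorem3 n G n≥36 planar = mk⇔
  (λ coloring → book⋢ G n≥4 coloring , star⋢ G n≥4 coloring , biclique⋢ G n≥4 coloring)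
  (λ (¬book , ¬star , ¬biclique) → CoHamiltonianPath⇒DifferentialColoring G
    (closure G λ H H≼G closed → closed⇒CoHamiltonianPath {H = H} n≥36 planar H≼G closed ¬book ¬star ¬biclique))
  where
  n≥4 : 4 ≤ n
  n≥4 = ≤-trans (m≤m+n 4 32) n≥36
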